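{- Let $p\ge5$ be a prime with Legendre symbol $\left(\frac{ -3}{p}\right)=-1$, and let $m\ge0$, $\alpha\ge0$, $n\ge0$ be integers. Then for every $i\in\{1,2,\dots,p-1\}$, $$\overline{S}_9^{\,4m+1}\big(6p^{2\alpha+2}n+(6i+p)p^{2\alpha+1}\big)\equiv0\pmod{8}.$$
   Context: For $|q|<1$ and a positive integer $k$, write $f_k=\prod_{j\ge1}(1-q^{kj})$. For a positive integer $r$, $\overline{S}_9^{\,r}(n)$ (number of $9$-Schur overpartitions of $n$ with $r$-tuples) is defined by $\sum_{n\ge0}\overline{S}_9^{\,r}(n)q^n=\prod_{n\ge1}\frac{(1+q^{2n-1})^r(1-q^{9(2n-1)})^r}{(1+q^{9(2n-1)})^r(1-q^{2n-1})^r}=\frac{f_2^{3r}f_9^{2r}f_{36}^r}{f_1^{2r}f_4^rf_{18}^{3r}}$. -}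

module Defs where

open import Data.Nat as ℕ using (ℕ; zero; suc; _≡ᵇ_)
open import Data.Nat.DivMod using (_%_; _/_)
open import Data.Bool using (if_then_else_)
open import Data.Integer as ℤ using (ℤ; +_; -_; _-_)
open import Data.Integer.Divisibility using (_∣_)
open import Data.Product using (∃)
open import Relation.Nullary using (¬_)

Series : Set
Series = ℕ → ℤ

one : Series
one zero    = + 1
one (suc _) = + 0

sumTo : (ℕ → ℤ) → ℕ → ℤ
sumTo f zero    = f zero
sumTo f (suc n) = sumTo f n ℤ.+ f (suc n)

_⊛_ : Series → Series → Series
(f ⊛ g) n = sumTo (λ i → f i ℤ.* g (n ℕ.∸ i)) n

infixl 7 _⊛_

_^ˢ_ : Series → ℕ → Series
f ^ˢ zero  = one
f ^ˢ suc r = f ⊛ (f ^ˢ r)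

-- 1 + ε q^k   (k ≥ 1, ε = ±1)
binom : ℤ → ℕ → Series
binom ε k zero    = + 1
binom ε k (suc n) = if (suc n ≡ᵇ k) then ε else + 0

-- 1 / (1 - q^(suc k)) = Σ_j q^((suc k) j)
geo : ℕ → Series
geo k n = if (n % suc k ≡ᵇ 0) then + 1 else + 0

-- 1 / (1 + q^(suc k)) = Σ_j (-1)^j q^((suc k) j)
altGeo : ℕ → Series
altGeo k n = if (n % suc k ≡ᵇ 0)
               then (if ((n / suc k) % 2 ≡ᵇ 0) then + 1 else - (+ 1))
               else + 0

-- the factor for odd part k = 2j+1:
--   (1 + q^k)(1 - q^(9k)) / ((1 + q^(9k))(1 - q^k))
factor : ℕ → Series
factor j = binom (+ 1) k ⊛ binom (- (+ 1)) (9 ℕ.* k) ⊛ geo (2 ℕ.* j) ⊛ altGeo (9 ℕ.* k ℕ.∸ 1)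
  where k = suc (2 ℕ.* j)

prodFactors : ℕ → Series
prodFactors zero    = one
prodFactors (suc J) = prodFactors J ⊛ factor J

-- coefficient of q^N in ∏_{n≥1} [ (1+q^{2n-1})(1-q^{9(2n-1)}) / ((1+q^{9(2n-1)})(1-q^{2n-1})) ]^r.
-- Factors with 2n-1 > N are ≡ 1 mod q^{N+1}, so the finite product over n ≤ N+1 suffices.
S9bar : ℕ → ℕ → ℤ
S9bar r N = (prodFactors (suc N) ^ˢ r) N

LegendreIsMinusOne : ℤ → ℕ → Set
LegendreIsMinusOne a p = ¬ (∃ λ (x : ℤ) → (+ p) ∣ (x ℤ.* x - a))

{-# OPTIONS --safe #-}
module Submission where

-- Write S = ∑ₙ S₉ʳ(n) qⁿ and D = q d/dq. Logarithmic differentiation of the product gives DS = r S L, where L has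
-- only odd powers of q, its n-th coefficient for odd n being 2 (∑ k [k ∣ n] - ∑ 9k [9k ∣ n]), k odd. Modulo 4,
-- S ≡ 1 + 2 r ∑ₖ (1 / (1 - qᵏ) + 1 / (1 + q⁹ᵏ) - 2), so that S(i) is even for i > 0, and divisible by 4 if moreover 3 ∣ i,
-- because then the odd divisors k of i with 9 ∤ k pair off as k, 3k with 3 ∤ k.
-- For odd n the coefficient L(n) is even, and divisible by 4 unless n ≡ 1 (mod 3): for 3 ∣ n by the same pairing,
-- and for n ≡ 2 (mod 3) because n is then not a square. If N ≡ 1 (mod 6), it follows that every term but the first of
-- N S(N) = r ∑ᵢ S(i) L(N - i) is divisible by 8, since L(N - i) ≠ 0 forces N - i to be odd and N - i ≡ 1 (mod 3) forces
-- 3 ∣ i. The first term is r L(N) = 2 r σ(N), whence N S(N) ≡ 2 r σ(N) (mod 8).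
-- For N = p^(2α+1) M with p ∤ M, the factors 1 + p and σ(M) of σ(N) are both even: p is odd, and p ≡ 2 (mod 3) makes
-- M ≡ 2 (mod 3) a nonsquare. Finally p ≡ 2 (mod 3) because F_p has no primitive cube root of unity, -3 not being a square.

open import Algebra.Bundles using (CommutativeRing)
import Algebra.Properties.Ring
import Algebra.Solver.Ring.NaturalCoefficients.Default
open import Data.Bool using (true; false; if_then_else_; T)
open import Data.Integer using (ℤ; +_; -_; _+_; _-_; _*_; ∣_∣; 0ℤ; 1ℤ; -1ℤ)
import Data.Integer.Divisibility as ℤ∣
open import Data.Integer.Divisibility.Signed using (_∣_; divides; ∣m∣n⇒∣m+n; ∣n⇒∣m*n; *-monoʳ-∣; *-monoˡ-∣; ∣-trans; ∣⇒∣ᵤ; ∣ᵤ⇒∣)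
import Data.Integer.Properties as ℤₚ
open import Data.Integer.Tactic.RingSolver using (solve-∀)
open import Data.Nat as ℕ using (ℕ; zero; suc; _∸_; _<_; _≤_; s≤s; z≤n; _≡ᵇ_; NonZero)
open import Data.Nat.Coprimality using (Coprime; coprime-Bézout)
open import Data.Nat.Divisibility as ℕ∣ using (_∣?_)
open import Data.Nat.DivMod as ℕ/ using (_%_; _/_)
open import Data.Nat.GCD using (module Bézout)
open import Data.Nat.Primality using (Prime; prime?; prime[2]; ¬prime[1]; euclidsLemma; prime⇒irreducible; prime⇒nonZero)
import Data.Nat.Properties as ℕₚ
import Data.Nat.Tactic.RingSolver as ℕ-RingSolver
open import Data.Product using (_×_; _,_; ∃-syntax)
open import Data.Sum as Sum using (inj₁; inj₂)
open import Function using (_∘_; id)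
open import Level using (0ℓ)
open import Relation.Binary.PropositionalEquality using (_≡_; _≢_; refl; sym; trans; cong; cong₂; subst; module ≡-Reasoning)
import Relation.Binary.Reasoning.Setoid as SetoidReasoning
open import Relation.Nullary using (¬_; Dec; does; yes; no; contradiction)
open import Relation.Nullary.Decidable using (dec-true; dec-false; toWitness; toWitnessFalse)
open import Defs

-- Finite sums over initial segments

∑ : ℕ → (ℕ → ℤ) → ℤ
∑ zero    f = 0ℤ
∑ (suc n) f = ∑ n f + f n

∑-cong : ∀ n {f g} → (∀ i → i < n → f i ≡ g i) → ∑ n f ≡ ∑ n g
∑-cong zero    f≗g = refl
∑-cong (suc n) f≗g = cong₂ _+_ (∑-cong n λ i i<n → f≗g i (ℕₚ.m<n⇒m<1+n i<n)) (f≗g n (ℕₚ.n<1+n n))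

∑-0 : ∀ n {f} → (∀ i → i < n → f i ≡ 0ℤ) → ∑ n f ≡ 0ℤ
∑-0 zero    f≗0 = refl
∑-0 (suc n) f≗0 = cong₂ _+_ (∑-0 n λ i i<n → f≗0 i (ℕₚ.m<n⇒m<1+n i<n)) (f≗0 n (ℕₚ.n<1+n n))

∑-distrib-+ : ∀ n f g → ∑ n (λ i → f i + g i) ≡ ∑ n f + ∑ n g
∑-distrib-+ zero    f g = refl
∑-distrib-+ (suc n) f g = trans (cong (_+ (f n + g n)) (∑-distrib-+ n f g)) (lemma (∑ n f) (∑ n g) (f n) (g n))
  where
  lemma : ∀ a b c d → a + b + (c + d) ≡ a + c + (b + d)
  lemma = solve-∀

*-distribˡ-∑ : ∀ n c f → c * ∑ n f ≡ ∑ n (λ i → c * f i)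
*-distribˡ-∑ zero    c f = ℤₚ.*-zeroʳ c
*-distribˡ-∑ (suc n) c f = trans (ℤₚ.*-distribˡ-+ c (∑ n f) (f n)) (cong (_+ c * f n) (*-distribˡ-∑ n c f))

∑-head : ∀ n f → ∑ (suc n) f ≡ f 0 + ∑ n (f ∘ suc)
∑-head zero    f = ℤₚ.+-comm 0ℤ (f 0)
∑-head (suc n) f = trans (cong (_+ f (suc n)) (∑-head n f)) (ℤₚ.+-assoc (f 0) (∑ n (f ∘ suc)) (f (suc n)))

∑-reverse : ∀ n f → ∑ n f ≡ ∑ n (λ i → f (n ∸ suc i))
∑-reverse zero    f = refl
∑-reverse (suc n) f = begin
  ∑ n f + f n                          ≡⟨ ℤₚ.+-comm (∑ n f) (f n) ⟩
  f n + ∑ n f                          ≡⟨ cong (_+_ (f n)) (∑-reverse n f) ⟩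
  f n + ∑ n (λ i → f (n ∸ suc i))      ≡⟨ ∑-head n (λ i → f (n ∸ i)) ⟨
  ∑ (suc n) (λ i → f (n ∸ i))          ∎
  where open ≡-Reasoning

∑-append : ∀ m n f → ∑ (n ℕ.+ m) f ≡ ∑ m f + ∑ n (λ i → f (i ℕ.+ m))
∑-append m zero    f = sym (ℤₚ.+-identityʳ (∑ m f))
∑-append m (suc n) f = trans (cong (_+ f (n ℕ.+ m)) (∑-append m n f))
  (ℤₚ.+-assoc (∑ m f) (∑ n (λ i → f (i ℕ.+ m))) (f (n ℕ.+ m)))

∑-∣ : ∀ n {d f} → (∀ i → i < n → d ∣ f i) → d ∣ ∑ n f
∑-∣ zero    d∣f = divides 0ℤ refl
∑-∣ (suc n) d∣f = ∣m∣n⇒∣m+n (∑-∣ n λ i i<n → d∣f i (ℕₚ.m<n⇒m<1+n i<n)) (d∣f n (ℕₚ.n<1+n n))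

∑-single : ∀ n {f} i → i < n → (∀ j → j < n → j ≢ i → f j ≡ 0ℤ) → ∑ n f ≡ f i
∑-single (suc n) {f} i i<1+n f≗0 with i ℕ.≟ n
... | yes refl = trans (cong (_+ f n) (∑-0 n λ j j<n → f≗0 j (ℕₚ.m<n⇒m<1+n j<n) (ℕₚ.<⇒≢ j<n))) (ℤₚ.+-identityˡ (f n))
... | no i≢n = trans (cong₂ _+_
  (∑-single n i (ℕₚ.≤∧≢⇒< (ℕ.s≤s⁻¹ i<1+n) i≢n) λ j j<n → f≗0 j (ℕₚ.m<n⇒m<1+n j<n))
  (f≗0 n (ℕₚ.n<1+n n) (i≢n ∘ sym))) (ℤₚ.+-identityʳ (f i))

sumTo≡∑ : ∀ f n → sumTo f n ≡ ∑ (suc n) f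
sumTo≡∑ f zero    = sym (ℤₚ.+-identityˡ (f 0))
sumTo≡∑ f (suc n) = cong (_+ f (suc n)) (sumTo≡∑ f n)

-- The commutative ring of formal power series

-- A record, so that the two series can be inferred from an equality.
infix 4 _≈_
record _≈_ (f g : Series) : Set where
  constructor pointwise
  field at : ∀ n → f n ≡ g n
open _≈_ public

infixl 6 _⊕_
_⊕_ : Series → Series → Series
(f ⊕ g) n = f n + g n

⊖_ : Series → Series
(⊖ f) n = - f n

𝟘 : Series
𝟘 _ = 0ℤ

⊛-∑ : ∀ f g n → (f ⊛ g) n ≡ ∑ (suc n) (λ i → f i * g (n ∸ i))
⊛-∑ f g n = sumTo≡∑ (λ i → f i * g (n ∸ i)) n

-- Peeling off the constant term of the left factor is the recursion behind associativity, the unit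
-- law and multiplication by a monomial.
⊛-suc : ∀ f g n → (f ⊛ g) (suc n) ≡ f 0 * g (suc n) + ((f ∘ suc) ⊛ g) n
⊛-suc f g n = trans (⊛-∑ f g (suc n)) (trans (∑-head (suc n) (λ i → f i * g (suc n ∸ i)))
  (cong (_+_ (f 0 * g (suc n))) (sym (⊛-∑ (f ∘ suc) g n))))

≈-refl : ∀ {f} → f ≈ f
≈-refl .at n = refl

≈-sym : ∀ {f g} → f ≈ g → g ≈ f
≈-sym f≈g .at n = sym (f≈g .at n)

≈-trans : ∀ {f g h} → f ≈ g → g ≈ h → f ≈ h
≈-trans f≈g g≈h .at n = trans (f≈g .at n) (g≈h .at n)

⊛-cong : ∀ {f f′ g g′} → f ≈ f′ → g ≈ g′ → f ⊛ g ≈ f′ ⊛ g′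
⊛-cong {f} {f′} {g} {g′} f≈f′ g≈g′ .at n = trans (⊛-∑ f g n) (trans
  (∑-cong (suc n) λ i _ → cong₂ _*_ (f≈f′ .at i) (g≈g′ .at (n ∸ i))) (sym (⊛-∑ f′ g′ n)))

⊛-congˡ : ∀ h {f g} → f ≈ g → h ⊛ f ≈ h ⊛ g
⊛-congˡ h = ⊛-cong {h} ≈-refl

⊛-congʳ : ∀ h {f g} → f ≈ g → f ⊛ h ≈ g ⊛ h
⊛-congʳ h f≈g = ⊛-cong {g = h} f≈g ≈-refl

⊛-comm : ∀ f g → f ⊛ g ≈ g ⊛ f
⊛-comm f g .at n = begin
  (f ⊛ g) n                                      ≡⟨ ⊛-∑ f g n ⟩
  ∑ (suc n) (λ i → f i * g (n ∸ i))              ≡⟨ ∑-reverse (suc n) (λ i → f i * g (n ∸ i)) ⟩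
  ∑ (suc n) (λ i → f (n ∸ i) * g (n ∸ (n ∸ i)))  ≡⟨ ∑-cong (suc n) (λ i i<1+n → trans
                                                    (cong (λ j → f (n ∸ i) * g j) (ℕₚ.m∸[m∸n]≡n (ℕ.s≤s⁻¹ i<1+n)))
                                                    (ℤₚ.*-comm (f (n ∸ i)) (g i))) ⟩
  ∑ (suc n) (λ i → g i * f (n ∸ i))              ≡⟨ ⊛-∑ g f n ⟨
  (g ⊛ f) n                                      ∎
  where open ≡-Reasoning

⊛-distribʳ : ∀ h f g → (f ⊕ g) ⊛ h ≈ f ⊛ h ⊕ g ⊛ h
⊛-distribʳ h f g .at n = begin
  ((f ⊕ g) ⊛ h) n                                                          ≡⟨ ⊛-∑ (f ⊕ g) h n ⟩
  ∑ (suc n) (λ i → (f i + g i) * h (n ∸ i))                                ≡⟨ ∑-cong (suc n) (λ i _ → ℤₚ.*-distribʳ-+ (h (n ∸ i)) (f i) (g i)) ⟩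
  ∑ (suc n) (λ i → f i * h (n ∸ i) + g i * h (n ∸ i))                      ≡⟨ ∑-distrib-+ (suc n) (λ i → f i * h (n ∸ i)) (λ i → g i * h (n ∸ i)) ⟩
  ∑ (suc n) (λ i → f i * h (n ∸ i)) + ∑ (suc n) (λ i → g i * h (n ∸ i))    ≡⟨ cong₂ _+_ (⊛-∑ f h n) (⊛-∑ g h n) ⟨
  (f ⊛ h) n + (g ⊛ h) n                                                    ∎
  where open ≡-Reasoning

⊛-scaleˡ : ∀ c f g → (λ n → c * f n) ⊛ g ≈ (λ n → c * (f ⊛ g) n)
⊛-scaleˡ c f g .at n = begin
  ((λ n → c * f n) ⊛ g) n                      ≡⟨ ⊛-∑ (λ n → c * f n) g n ⟩
  ∑ (suc n) (λ i → c * f i * g (n ∸ i))        ≡⟨ ∑-cong (suc n) (λ i _ → ℤₚ.*-assoc c (f i) (g (n ∸ i))) ⟩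
  ∑ (suc n) (λ i → c * (f i * g (n ∸ i)))      ≡⟨ *-distribˡ-∑ (suc n) c (λ i → f i * g (n ∸ i)) ⟨
  c * ∑ (suc n) (λ i → f i * g (n ∸ i))        ≡⟨ cong (c *_) (⊛-∑ f g n) ⟨
  c * (f ⊛ g) n                                ∎
  where open ≡-Reasoning

⊛-assoc : ∀ f g h → (f ⊛ g) ⊛ h ≈ f ⊛ (g ⊛ h)
⊛-assoc f g h .at n = go n f
  where
  open ≡-Reasoning
  lemma : ∀ a b c d e → a * b * c + (a * d + e) ≡ a * (b * c + d) + e
  lemma = solve-∀
  -- Generalised over `f`, since the induction hypothesis is applied to the shift `f ∘ suc`.
  go : ∀ n f → ((f ⊛ g) ⊛ h) n ≡ (f ⊛ (g ⊛ h)) n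
  go zero    f = ℤₚ.*-assoc (f 0) (g 0) (h 0)
  go (suc n) f = begin
    ((f ⊛ g) ⊛ h) (suc n)
      ≡⟨ ⊛-suc (f ⊛ g) h n ⟩
    f 0 * g 0 * h (suc n) + (((f ⊛ g) ∘ suc) ⊛ h) n
      ≡⟨ cong (_+_ (f 0 * g 0 * h (suc n))) (begin
        (((f ⊛ g) ∘ suc) ⊛ h) n
          ≡⟨ ⊛-congʳ h (pointwise (⊛-suc f g)) .at n ⟩
        (((λ i → f 0 * g (suc i)) ⊕ (f ∘ suc) ⊛ g) ⊛ h) n
          ≡⟨ ⊛-distribʳ h (λ i → f 0 * g (suc i)) ((f ∘ suc) ⊛ g) .at n ⟩
        ((λ i → f 0 * g (suc i)) ⊛ h) n + (((f ∘ suc) ⊛ g) ⊛ h) n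
          ≡⟨ cong₂ _+_ (⊛-scaleˡ (f 0) (g ∘ suc) h .at n) (go n (f ∘ suc)) ⟩
        f 0 * ((g ∘ suc) ⊛ h) n + ((f ∘ suc) ⊛ (g ⊛ h)) n ∎) ⟩
    f 0 * g 0 * h (suc n) + (f 0 * ((g ∘ suc) ⊛ h) n + ((f ∘ suc) ⊛ (g ⊛ h)) n)
      ≡⟨ lemma (f 0) (g 0) (h (suc n)) (((g ∘ suc) ⊛ h) n) (((f ∘ suc) ⊛ (g ⊛ h)) n) ⟩
    f 0 * (g 0 * h (suc n) + ((g ∘ suc) ⊛ h) n) + ((f ∘ suc) ⊛ (g ⊛ h)) n
      ≡⟨ cong (λ x → f 0 * x + ((f ∘ suc) ⊛ (g ⊛ h)) n) (⊛-suc g h n) ⟨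
    f 0 * (g ⊛ h) (suc n) + ((f ∘ suc) ⊛ (g ⊛ h)) n
      ≡⟨ ⊛-suc f (g ⊛ h) n ⟨
    (f ⊛ (g ⊛ h)) (suc n) ∎

⊛-identityˡ : ∀ f → one ⊛ f ≈ f
⊛-identityˡ f .at zero    = ℤₚ.*-identityˡ (f 0)
⊛-identityˡ f .at (suc n) = begin
  (one ⊛ f) (suc n)                          ≡⟨ ⊛-suc one f n ⟩
  1ℤ * f (suc n) + ((λ _ → 0ℤ) ⊛ f) n        ≡⟨ cong₂ _+_ (ℤₚ.*-identityˡ (f (suc n)))
                                                (trans (⊛-∑ (λ _ → 0ℤ) f n) (∑-0 (suc n) λ _ _ → refl)) ⟩
  f (suc n) + 0ℤ                             ≡⟨ ℤₚ.+-identityʳ (f (suc n)) ⟩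
  f (suc n)                                  ∎
  where open ≡-Reasoning

-- Makes a semiring solver available for series. That solver knows no subtraction, so the identities
-- passed to it use sums and products only.
seriesRing : CommutativeRing 0ℓ 0ℓ
seriesRing = record
  { Carrier = Series ; _≈_ = _≈_ ; _+_ = _⊕_ ; _*_ = _⊛_ ; -_ = ⊖_ ; 0# = 𝟘 ; 1# = one
  ; isCommutativeRing = record
    { isRing = record
      { +-isAbelianGroup = record
        { isGroup = record
          { isMonoid = record
            { isSemigroup = record
              { isMagma = record
                { isEquivalence = record { refl = ≈-refl ; sym = ≈-sym ; trans = ≈-trans }
                ; ∙-cong = λ p q → pointwise λ n → cong₂ _+_ (p .at n) (q .at n) }
              ; assoc = λ f g h → pointwise λ n → ℤₚ.+-assoc (f n) (g n) (h n) }
            ; identity = (λ f → pointwise λ n → ℤₚ.+-identityˡ (f n)) , (λ f → pointwise λ n → ℤₚ.+-identityʳ (f n)) }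
          ; inverse = (λ f → pointwise λ n → ℤₚ.+-inverseˡ (f n)) , (λ f → pointwise λ n → ℤₚ.+-inverseʳ (f n))
          ; ⁻¹-cong = λ p → pointwise λ n → cong -_ (p .at n) }
        ; comm = λ f g → pointwise λ n → ℤₚ.+-comm (f n) (g n) }
      ; *-cong = ⊛-cong
      ; *-assoc = ⊛-assoc
      ; *-identity = ⊛-identityˡ , (λ f → ≈-trans (⊛-comm f one) (⊛-identityˡ f))
      ; distrib = (λ h f g → ≈-trans (⊛-comm h (f ⊕ g)) (≈-trans (⊛-distribʳ h f g)
                    (pointwise λ n → cong₂ _+_ (⊛-comm f h .at n) (⊛-comm g h .at n)))) , ⊛-distribʳ }
    ; *-comm = ⊛-comm } }

open CommutativeRing seriesRing using (setoid; commutativeSemiring; +-cong) renaming (zeroʳ to ⊛-zeroʳ; *-identityʳ to ⊛-identityʳ)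
open Algebra.Properties.Ring (CommutativeRing.ring seriesRing) using (-‿distribʳ-*; +-inverseˡ-unique; x[y-z]≈xy-xz)
module SeriesSolver = Algebra.Solver.Ring.NaturalCoefficients.Default commutativeSemiring
open SeriesSolver using (_:+_; _:*_; _:=_; con)

-- Logarithmic derivatives

infixr 7 _·_
_·_ : ℤ → Series → Series
(c · f) n = c * f n

D : Series → Series
D f n = + n * f n

D-⊛ : ∀ f g → D (f ⊛ g) ≈ D f ⊛ g ⊕ f ⊛ D g
D-⊛ f g .at n = begin
  + n * (f ⊛ g) n
    ≡⟨ cong (_*_ (+ n)) (⊛-∑ f g n) ⟩
  + n * ∑ (suc n) (λ i → f i * g (n ∸ i))
    ≡⟨ *-distribˡ-∑ (suc n) (+ n) (λ i → f i * g (n ∸ i)) ⟩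
  ∑ (suc n) (λ i → + n * (f i * g (n ∸ i)))
    ≡⟨ ∑-cong (suc n) (λ i i<1+n → trans
        (cong (λ m → + m * (f i * g (n ∸ i))) (sym (ℕₚ.m+[n∸m]≡n (ℕ.s≤s⁻¹ i<1+n))))
        (lemma (+ i) (+ (n ∸ i)) (f i) (g (n ∸ i)))) ⟩
  ∑ (suc n) (λ i → D f i * g (n ∸ i) + f i * D g (n ∸ i))
    ≡⟨ ∑-distrib-+ (suc n) (λ i → D f i * g (n ∸ i)) (λ i → f i * D g (n ∸ i)) ⟩
  ∑ (suc n) (λ i → D f i * g (n ∸ i)) + ∑ (suc n) (λ i → f i * D g (n ∸ i))
    ≡⟨ cong₂ _+_ (⊛-∑ (D f) g n) (⊛-∑ f (D g) n) ⟨
  (D f ⊛ g ⊕ f ⊛ D g) n ∎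
  where
  open ≡-Reasoning
  lemma : ∀ i j x y → (i + j) * (x * y) ≡ i * x * y + x * (j * y)
  lemma = solve-∀

-- The quotient D f / f in division-free form; it turns products of series into sums.
record LogDerivative (f ℓ : Series) : Set where
  constructor logDerivative
  field D≈ : D f ≈ f ⊛ ℓ
open LogDerivative public

logDerivative-⊛ : ∀ f g {ℓ ℓ′} → LogDerivative f ℓ → LogDerivative g ℓ′ → LogDerivative (f ⊛ g) (ℓ ⊕ ℓ′)
logDerivative-⊛ f g {ℓ} {ℓ′} Df Dg .D≈ = begin
  D (f ⊛ g)                        ≈⟨ D-⊛ f g ⟩
  D f ⊛ g ⊕ f ⊛ D g                ≈⟨ +-cong (⊛-congʳ g (Df .D≈)) (⊛-congˡ f (Dg .D≈)) ⟩
  (f ⊛ ℓ) ⊛ g ⊕ f ⊛ (g ⊛ ℓ′)       ≈⟨ lemma f g ℓ ℓ′ ⟩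
  f ⊛ g ⊛ (ℓ ⊕ ℓ′)                 ∎
  where
  open SetoidReasoning setoid
  lemma : ∀ f g ℓ ℓ′ → (f ⊛ ℓ) ⊛ g ⊕ f ⊛ (g ⊛ ℓ′) ≈ f ⊛ g ⊛ (ℓ ⊕ ℓ′)
  lemma = SeriesSolver.solve 4 (λ f g ℓ ℓ′ → (f :* ℓ) :* g :+ f :* (g :* ℓ′) := f :* g :* (ℓ :+ ℓ′)) ≈-refl

logDerivative-one : LogDerivative one 𝟘
logDerivative-one .D≈ = ≈-trans D-one (≈-sym (⊛-zeroʳ one))
  where
  D-one : D one ≈ 𝟘
  D-one .at zero    = refl
  D-one .at (suc n) = ℤₚ.*-zeroʳ (+ suc n)

logDerivative-^ : ∀ {f ℓ} r → LogDerivative f ℓ → LogDerivative (f ^ˢ r) (+ r · ℓ)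
logDerivative-^ zero    Df = logDerivative-one
logDerivative-^ {f} {ℓ} (suc r) Df .D≈ = ≈-trans (logDerivative-⊛ f (f ^ˢ r) Df (logDerivative-^ r Df) .D≈)
  (⊛-congˡ (f ^ˢ suc r) (pointwise λ n → sym (ℤₚ.suc-* (+ r) (ℓ n))))

-- Differentiating f g = 1 gives f g ℓ + f D g = 0. Multiplying by g and using f g = 1 once more
-- leaves D g + g ℓ = 0.
logDerivative-inverse : ∀ f g {ℓ} → LogDerivative f ℓ → f ⊛ g ≈ one → LogDerivative g (⊖ ℓ)
logDerivative-inverse f g {ℓ} Df fg≈1 .D≈ = begin
  D g          ≈⟨ +-inverseˡ-unique (D g) (g ⊛ ℓ) Dg+gℓ≈0 ⟩
  ⊖ (g ⊛ ℓ)    ≈⟨ -‿distribʳ-* g ℓ ⟩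
  g ⊛ ⊖ ℓ      ∎
  where
  open SetoidReasoning setoid
  lemma : ∀ f g d ℓ → (f ⊛ g) ⊛ (d ⊕ g ⊛ ℓ) ≈ g ⊛ ((f ⊛ ℓ) ⊛ g ⊕ f ⊛ d)
  lemma = SeriesSolver.solve 4 (λ f g d ℓ → (f :* g) :* (d :+ g :* ℓ) := g :* ((f :* ℓ) :* g :+ f :* d)) ≈-refl
  vanishes : (f ⊛ ℓ) ⊛ g ⊕ f ⊛ D g ≈ 𝟘
  vanishes = begin
    (f ⊛ ℓ) ⊛ g ⊕ f ⊛ D g    ≈⟨ +-cong (⊛-congʳ g (Df .D≈)) ≈-refl ⟨
    D f ⊛ g ⊕ f ⊛ D g        ≈⟨ D-⊛ f g ⟨
    D (f ⊛ g)                ≈⟨ pointwise (λ n → cong (_*_ (+ n)) (fg≈1 .at n)) ⟩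
    D one                    ≈⟨ logDerivative-one .D≈ ⟩
    one ⊛ 𝟘                  ≈⟨ ⊛-zeroʳ one ⟩
    𝟘                        ∎
  Dg+gℓ≈0 : D g ⊕ g ⊛ ℓ ≈ 𝟘
  Dg+gℓ≈0 = begin
    D g ⊕ g ⊛ ℓ                        ≈⟨ ⊛-identityˡ (D g ⊕ g ⊛ ℓ) ⟨
    one ⊛ (D g ⊕ g ⊛ ℓ)                ≈⟨ ⊛-congʳ (D g ⊕ g ⊛ ℓ) fg≈1 ⟨
    (f ⊛ g) ⊛ (D g ⊕ g ⊛ ℓ)            ≈⟨ lemma f g (D g) ℓ ⟩
    g ⊛ ((f ⊛ ℓ) ⊛ g ⊕ f ⊛ D g)        ≈⟨ ⊛-congˡ g vanishes ⟩
    g ⊛ 𝟘                              ≈⟨ ⊛-zeroʳ g ⟩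
    𝟘                                  ∎

-- With b = 1 + ε q^K and K = k + 1, one has D b = K (b - 1), and b v = 1 turns b - 1 into b (1 -
-- v).
logDerivative-binom : ∀ ε k v → binom ε (suc k) ⊛ v ≈ one →
                      LogDerivative (binom ε (suc k)) (+ suc k · (one ⊕ ⊖ v))
logDerivative-binom ε k v bv≈1 .D≈ = begin
  D b                                ≈⟨ pointwise D-b ⟩
  + suc k · (b ⊕ ⊖ one)              ≈⟨ pointwise (λ n → cong₂ (λ x y → + suc k * (x - y))
                                        (⊛-identityʳ b .at n) (bv≈1 .at n)) ⟨
  + suc k · (b ⊛ one ⊕ ⊖ (b ⊛ v))    ≈⟨ pointwise (λ n → cong (_*_ (+ suc k)) (x[y-z]≈xy-xz b one v .at n)) ⟨
  + suc k · (b ⊛ (one ⊕ ⊖ v))        ≈⟨ pointwise (λ n → cong (_*_ (+ suc k)) (⊛-comm b (one ⊕ ⊖ v) .at n)) ⟩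
  + suc k · ((one ⊕ ⊖ v) ⊛ b)        ≈⟨ ⊛-scaleˡ (+ suc k) (one ⊕ ⊖ v) b ⟨
  (+ suc k · (one ⊕ ⊖ v)) ⊛ b        ≈⟨ ⊛-comm (+ suc k · (one ⊕ ⊖ v)) b ⟩
  b ⊛ (+ suc k · (one ⊕ ⊖ v))        ∎
  where
  open SetoidReasoning setoid
  b = binom ε (suc k)
  D-b : ∀ n → + n * b n ≡ + suc k * (b n - one n)
  D-b zero    = sym (ℤₚ.*-zeroʳ (+ suc k))
  D-b (suc n) with n ≡ᵇ k in eq
  ... | true  = cong₂ _*_ (cong (λ m → + suc m) (ℕₚ.≡ᵇ⇒≡ n k (subst T (sym eq) _))) (sym (ℤₚ.+-identityʳ ε))
  ... | false = trans (ℤₚ.*-zeroʳ (+ suc n)) (sym (ℤₚ.*-zeroʳ (+ suc k)))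

-- Geometric series as inverses of 1 - q^k and 1 + q^k

monomial : ℕ → Series
monomial k n = if n ≡ᵇ k then 1ℤ else 0ℤ

monomial-⊛-< : ∀ k f n → n < k → (monomial k ⊛ f) n ≡ 0ℤ
monomial-⊛-< (suc k) f zero    _         = refl
monomial-⊛-< (suc k) f (suc n) (s≤s n<k) = trans (⊛-suc (monomial (suc k)) f n)
  (trans (ℤₚ.+-identityˡ _) (monomial-⊛-< k f n n<k))

monomial-⊛-+ : ∀ k f n → (monomial k ⊛ f) (n ℕ.+ k) ≡ f n
monomial-⊛-+ zero    f n = trans (cong (monomial 0 ⊛ f) (ℕₚ.+-identityʳ n))
  (trans (⊛-congʳ f monomial-0 .at n) (⊛-identityˡ f .at n))
  where
  monomial-0 : monomial 0 ≈ one
  monomial-0 .at zero    = refl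
  monomial-0 .at (suc n) = refl
monomial-⊛-+ (suc k) f n = trans (cong (monomial (suc k) ⊛ f) (ℕₚ.+-suc n k))
  (trans (⊛-suc (monomial (suc k)) f (n ℕ.+ k)) (trans (ℤₚ.+-identityˡ _) (monomial-⊛-+ k f n)))

binom-⊛ : ∀ ε k f n → (binom ε (suc k) ⊛ f) n ≡ f n + ε * (monomial (suc k) ⊛ f) n
binom-⊛ ε k f n = trans (⊛-congʳ f (pointwise split) .at n)
  (trans (⊛-distribʳ f one (ε · monomial (suc k)) .at n)
    (cong₂ _+_ (⊛-identityˡ f .at n) (⊛-scaleˡ ε (monomial (suc k)) f .at n)))
  where
  split : ∀ n → binom ε (suc k) n ≡ (one ⊕ ε · monomial (suc k)) n
  split zero    = cong (_+_ 1ℤ) (sym (ℤₚ.*-zeroʳ ε))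
  split (suc n) with n ≡ᵇ k
  ... | true  = sym (trans (ℤₚ.+-identityˡ _) (ℤₚ.*-identityʳ ε))
  ... | false = sym (trans (ℤₚ.+-identityˡ _) (ℤₚ.*-zeroʳ ε))

-- Multiplication by 1 + ε q^K, K = k + 1, produces v(n) + ε v(n - K), the second term being absent
-- for n < K. Inverses are thus recognised by a recurrence, which the periodic `geo` and `altGeo`
-- satisfy.
binom-inverse : ∀ ε k {v} → (∀ n → n < suc k → v n ≡ one n) → (∀ n → v (n ℕ.+ suc k) ≡ - (ε * v n)) →
                binom ε (suc k) ⊛ v ≈ one
binom-inverse ε k {v} initial periodic .at n with n ℕ.<? suc k
... | yes n<k = begin
  (binom ε (suc k) ⊛ v) n              ≡⟨ binom-⊛ ε k v n ⟩
  v n + ε * (monomial (suc k) ⊛ v) n   ≡⟨ cong₂ (λ x y → x + ε * y) (initial n n<k) (monomial-⊛-< (suc k) v n n<k) ⟩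
  one n + ε * 0ℤ                       ≡⟨ cong (_+_ (one n)) (ℤₚ.*-zeroʳ ε) ⟩
  one n + 0ℤ                           ≡⟨ ℤₚ.+-identityʳ (one n) ⟩
  one n                                ∎
  where open ≡-Reasoning
... | no n≮k = subst (λ m → (binom ε (suc k) ⊛ v) m ≡ one m) (ℕₚ.m∸n+n≡m (ℕₚ.≮⇒≥ n≮k)) (begin
  (binom ε (suc k) ⊛ v) (m ℕ.+ suc k)                        ≡⟨ binom-⊛ ε k v (m ℕ.+ suc k) ⟩
  v (m ℕ.+ suc k) + ε * (monomial (suc k) ⊛ v) (m ℕ.+ suc k) ≡⟨ cong₂ (λ x y → x + ε * y) (periodic m) (monomial-⊛-+ (suc k) v m) ⟩
  - (ε * v m) + ε * v m                                      ≡⟨ ℤₚ.+-inverseˡ (ε * v m) ⟩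
  0ℤ                                                         ≡⟨ cong one (ℕₚ.+-suc m k) ⟨
  one (m ℕ.+ suc k)                                          ∎)
  where
  open ≡-Reasoning
  m = n ∸ suc k

ind : {P : Set} → Dec P → ℤ
ind P? = if does P? then 1ℤ else 0ℤ

ind-yes : ∀ {P : Set} (P? : Dec P) → P → ind P? ≡ 1ℤ
ind-yes P? p = cong (λ b → if b then 1ℤ else 0ℤ) (dec-true P? p)

ind-no : ∀ {P : Set} (P? : Dec P) → ¬ P → ind P? ≡ 0ℤ
ind-no P? ¬p = cong (λ b → if b then 1ℤ else 0ℤ) (dec-false P? ¬p)

geo-∣ : ∀ {k n} → suc k ℕ∣.∣ n → geo k n ≡ 1ℤ
geo-∣ {k} {n} k∣n = cong (λ r → if r ≡ᵇ 0 then 1ℤ else 0ℤ) (ℕ∣.n∣m⇒m%n≡0 n (suc k) k∣n)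

geo-∤ : ∀ {k n} → ¬ suc k ℕ∣.∣ n → geo k n ≡ 0ℤ
geo-∤ {k} {n} k∤n with n % suc k in eq
... | zero  = contradiction (ℕ∣.m%n≡0⇒n∣m n (suc k) eq) k∤n
... | suc _ = refl

geo-ind : ∀ k n → geo k n ≡ ind (suc k ∣? n)
geo-ind k n with suc k ∣? n in eq
... | yes k∣n = trans (geo-∣ k∣n) (sym (cong ind eq))
... | no  k∤n = trans (geo-∤ k∤n) (sym (cong ind eq))

-- (-1)^q, in the shape in which it occurs inside `altGeo`.
sgn : ℕ → ℤ
sgn q = if q % 2 ≡ᵇ 0 then 1ℤ else -1ℤ

sgn-suc : ∀ q → sgn (suc q) ≡ - sgn q
sgn-suc zero          = refl
sgn-suc (suc zero)    = refl
sgn-suc (suc (suc q)) = sgn-suc q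

sgn-even : ∀ q → 2 ℕ∣.∣ q → sgn q ≡ 1ℤ
sgn-even q 2∣q = cong (λ r → if r ≡ᵇ 0 then 1ℤ else -1ℤ) (ℕ∣.n∣m⇒m%n≡0 q 2 2∣q)

sgn-odd : ∀ q → ¬ 2 ℕ∣.∣ q → sgn q ≡ -1ℤ
sgn-odd q 2∤q with q % 2 in eq
... | zero  = contradiction (ℕ∣.m%n≡0⇒n∣m q 2 eq) 2∤q
... | suc _ = refl

altGeo-* : ∀ k q → altGeo k (q ℕ.* suc k) ≡ sgn q
altGeo-* k q = cong₂ (λ r s → if r ≡ᵇ 0 then sgn s else 0ℤ) (ℕ/.m*n%n≡0 q (suc k)) (ℕ/.m*n/n≡m q (suc k))

altGeo-∤ : ∀ {k n} → ¬ suc k ℕ∣.∣ n → altGeo k n ≡ 0ℤ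
altGeo-∤ {k} {n} k∤n with n % suc k in eq
... | zero  = contradiction (ℕ∣.m%n≡0⇒n∣m n (suc k) eq) k∤n
... | suc _ = refl

∣n+k⇒∣n : ∀ {k n} → k ℕ∣.∣ n ℕ.+ k → k ℕ∣.∣ n
∣n+k⇒∣n {k} {n} k∣n+k = ℕ∣.∣m+n∣m⇒∣n (subst (k ℕ∣.∣_) (ℕₚ.+-comm n k) k∣n+k) ℕ∣.∣-refl

small-∤ : ∀ {k n} → suc n < suc k → ¬ suc k ℕ∣.∣ suc n
small-∤ n<k k∣n = ℕₚ.<⇒≱ n<k (ℕ∣.∣⇒≤ k∣n)

binom-geo : ∀ k → binom -1ℤ (suc k) ⊛ geo k ≈ one
binom-geo k = binom-inverse -1ℤ k initial periodic
  where
  initial : ∀ n → n < suc k → geo k n ≡ one n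
  initial zero    _   = refl
  initial (suc n) n<k = geo-∤ (small-∤ n<k)
  periodic : ∀ n → geo k (n ℕ.+ suc k) ≡ - (-1ℤ * geo k n)
  periodic n = trans (cong (λ r → if r ≡ᵇ 0 then 1ℤ else 0ℤ) (ℕ/.[m+n]%n≡m%n n (suc k))) (lemma (geo k n))
    where
    lemma : ∀ x → x ≡ - (-1ℤ * x)
    lemma x = sym (trans (cong -_ (ℤₚ.-1*i≡-i x)) (ℤₚ.neg-involutive x))

binom-altGeo : ∀ k → binom 1ℤ (suc k) ⊛ altGeo k ≈ one
binom-altGeo k = binom-inverse 1ℤ k initial periodic
  where
  open ≡-Reasoning
  initial : ∀ n → n < suc k → altGeo k n ≡ one n
  initial zero    _   = refl
  initial (suc n) n<k = altGeo-∤ (small-∤ n<k)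
  periodic : ∀ n → altGeo k (n ℕ.+ suc k) ≡ - (1ℤ * altGeo k n)
  periodic n with suc k ∣? n
  ... | no k∤n = trans (altGeo-∤ (k∤n ∘ ∣n+k⇒∣n)) (sym (cong (λ x → - (1ℤ * x)) (altGeo-∤ k∤n)))
  ... | yes (ℕ∣.divides q refl) = begin
    altGeo k (q ℕ.* suc k ℕ.+ suc k)     ≡⟨ cong (altGeo k) (ℕₚ.+-comm (q ℕ.* suc k) (suc k)) ⟩
    altGeo k (suc q ℕ.* suc k)           ≡⟨ altGeo-* k (suc q) ⟩
    sgn (suc q)                          ≡⟨ sgn-suc q ⟩
    - sgn q                              ≡⟨ cong -_ (trans (ℤₚ.*-identityˡ _) (altGeo-* k q)) ⟨
    - (1ℤ * altGeo k (q ℕ.* suc k))      ∎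

2∣m*odd⇒2∣m : ∀ {m n} → ¬ 2 ℕ∣.∣ n → 2 ℕ∣.∣ m ℕ.* n → 2 ℕ∣.∣ m
2∣m*odd⇒2∣m {m} {n} 2∤n 2∣mn = Sum.[ id , (λ 2∣n → contradiction 2∣n 2∤n) ] (euclidsLemma m n prime[2] 2∣mn)

-- An even multiple t K of an odd K = k + 1 has t even, so the sign (-1)^t is positive.
altGeo-even : ∀ {k n} → ¬ 2 ℕ∣.∣ suc k → 2 ℕ∣.∣ n → altGeo k n ≡ geo k n
altGeo-even {k} {n} k-odd 2∣n with suc k ∣? n
... | no k∤n = trans (altGeo-∤ k∤n) (sym (geo-∤ k∤n))
... | yes k∣n@(ℕ∣.divides q refl) =
  trans (altGeo-* k q) (trans (sgn-even q (2∣m*odd⇒2∣m k-odd 2∣n)) (sym (geo-∣ k∣n)))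

-- A divisor of an odd n has an odd cofactor, so every sign that occurs is negative.
altGeo-odd : ∀ {k n} → ¬ 2 ℕ∣.∣ n → altGeo k n ≡ - geo k n
altGeo-odd {k} {n} n-odd with suc k ∣? n
... | no k∤n = trans (altGeo-∤ k∤n) (sym (cong -_ (geo-∤ k∤n)))
... | yes k∣n@(ℕ∣.divides q refl) =
  trans (altGeo-* k q) (trans (sgn-odd q (n-odd ∘ ℕ∣.∣m⇒∣m*n (suc k))) (sym (cong -_ (geo-∣ k∣n))))

altGeo-geo-mod2 : ∀ k n → + 2 ∣ altGeo k n - geo k n
altGeo-geo-mod2 k n with suc k ∣? n
... | no k∤n = divides 0ℤ (cong₂ _-_ (altGeo-∤ k∤n) (geo-∤ k∤n))
... | yes k∣n@(ℕ∣.divides q refl) with q % 2 ≡ᵇ 0 in eq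
...   | true  = divides 0ℤ (cong₂ _-_ (trans (altGeo-* k q) (cong (λ b → if b then 1ℤ else -1ℤ) eq)) (geo-∣ k∣n))
...   | false = divides -1ℤ (cong₂ _-_ (trans (altGeo-* k q) (cong (λ b → if b then 1ℤ else -1ℤ) eq)) (geo-∣ k∣n))

-- A single factor of the product and its logarithmic derivative

-- factorOf (k - 1) (l - 1) is (1 + q^k)(1 - q^l) / ((1 - q^k)(1 + q^l)), with the index shift of geo and altGeo.
factorOf : ℕ → ℕ → Series
factorOf k l = binom 1ℤ (suc k) ⊛ binom -1ℤ (suc l) ⊛ geo k ⊛ altGeo l

-- The summands belong, in order, to 1 + q^K, 1 - q^L, 1 / (1 - q^K) and 1 / (1 + q^L), where K = k
-- + 1 and L = l + 1.
logFactor : ℕ → ℕ → Series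
logFactor k l = + suc k · (one ⊕ ⊖ altGeo k) ⊕ + suc l · (one ⊕ ⊖ geo l)
  ⊕ ⊖ (+ suc k · (one ⊕ ⊖ geo k)) ⊕ ⊖ (+ suc l · (one ⊕ ⊖ altGeo l))

logDerivative-factorOf : ∀ k l → LogDerivative (factorOf k l) (logFactor k l)
logDerivative-factorOf k l =
  logDerivative-⊛ (b ⊛ c ⊛ geo k) (altGeo l)
    (logDerivative-⊛ (b ⊛ c) (geo k)
      (logDerivative-⊛ b c
        (logDerivative-binom 1ℤ k (altGeo k) (binom-altGeo k))
        (logDerivative-binom -1ℤ l (geo l) (binom-geo l)))
      (logDerivative-inverse (binom -1ℤ (suc k)) (geo k)
        (logDerivative-binom -1ℤ k (geo k) (binom-geo k)) (binom-geo k)))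
    (logDerivative-inverse (binom 1ℤ (suc l)) (altGeo l)
      (logDerivative-binom 1ℤ l (altGeo l) (binom-altGeo l)) (binom-altGeo l))
  where
  b = binom 1ℤ (suc k)
  c = binom -1ℤ (suc l)

-- At even exponents the plain and the alternating series agree, so 1 + q^K cancels against 1 / (1 -
-- q^K), and likewise for L.
logFactor-even : ∀ {k l n} → ¬ 2 ℕ∣.∣ suc k → ¬ 2 ℕ∣.∣ suc l → 2 ℕ∣.∣ n → logFactor k l n ≡ 0ℤ
logFactor-even {k} {l} {n} k-odd l-odd 2∣n = trans
  (cong₂ (λ a b → + suc k * (one n + - a) + + suc l * (one n + - geo l n)
    + - (+ suc k * (one n + - geo k n)) + - (+ suc l * (one n + - b)))
    (altGeo-even k-odd 2∣n) (altGeo-even l-odd 2∣n))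
  (lemma (+ suc k) (+ suc l) (one n) (geo k n) (geo l n))
  where
  lemma : ∀ k l o a b → k * (o + - a) + l * (o + - b) + - (k * (o + - a)) + - (l * (o + - b)) ≡ 0ℤ
  lemma = solve-∀

-- At odd exponents the alternating series is the negative of the plain one, so the contributions
-- add up in pairs; hence the factor 2.
logFactor-odd : ∀ {k l n} → ¬ 2 ℕ∣.∣ n → logFactor k l n ≡
                + 2 * (+ suc k * ind (suc k ∣? n) - + suc l * ind (suc l ∣? n))
logFactor-odd {k} {l} {n} 2∤n = trans
  (cong₂ (λ a b → + suc k * (one n + - a) + + suc l * (one n + - geo l n)
    + - (+ suc k * (one n + - geo k n)) + - (+ suc l * (one n + - b)))
    (altGeo-odd 2∤n) (altGeo-odd 2∤n))
  (trans (lemma (+ suc k) (+ suc l) (one n) (geo k n) (geo l n))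
  (cong₂ (λ a b → + 2 * (+ suc k * a - + suc l * b)) (geo-ind k n) (geo-ind l n)))
  where
  lemma : ∀ k l o a b → k * (o + - - a) + l * (o + - b) + - (k * (o + - a)) + - (l * (o + - - b))
        ≡ + 2 * (k * a - l * b)
  lemma = solve-∀

-- Series modulo 4

infix 4 _≡1+2_mod4
-- Congruence modulo 4 to 1 + 2 `e`, with the quotient as data. The multiples by 2 and 4 are spelled
-- out as repeated sums, the form that suits the semiring solver.
record _≡1+2_mod4 (f e : Series) : Set where
  constructor _,_
  field
    quarter  : Series
    equality : f ≈ one ⊕ (e ⊕ e) ⊕ ((quarter ⊕ quarter) ⊕ (quarter ⊕ quarter))

quadruple : Series → Series
quadruple x = (x ⊕ x) ⊕ (x ⊕ x)

-- (1 + 2 e)(1 + 2 e′) = 1 + 2 (e + e′) + 4 e e′. The other two summands of the new quotient carry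
-- the quotients of the factors.
⊛-mod4 : ∀ {f g e e′} → f ≡1+2 e mod4 → g ≡1+2 e′ mod4 → f ⊛ g ≡1+2 e ⊕ e′ mod4
⊛-mod4 {f} {g} {e} {e′} (x , f≈) (y , g≈) = x ⊛ g ⊕ a ⊛ y ⊕ e ⊛ e′ , (begin
  f ⊛ g                                                                             ≈⟨ ⊛-congʳ g f≈ ⟩
  (a ⊕ quadruple x) ⊛ g                                                             ≈⟨ expandʳ a x g ⟩
  a ⊛ g ⊕ quadruple (x ⊛ g)                                                         ≈⟨ +-cong (⊛-congˡ a g≈) ≈-refl ⟩
  a ⊛ (a′ ⊕ quadruple y) ⊕ quadruple (x ⊛ g)                                        ≈⟨ +-cong (expandˡ a a′ y) ≈-refl ⟩
  a ⊛ a′ ⊕ quadruple (a ⊛ y) ⊕ quadruple (x ⊛ g)                                    ≈⟨ +-cong (+-cong (expand e e′) ≈-refl) ≈-refl ⟩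
  one ⊕ ((e ⊕ e′) ⊕ (e ⊕ e′)) ⊕ quadruple (e ⊛ e′) ⊕ quadruple (a ⊛ y) ⊕ quadruple (x ⊛ g)
    ≈⟨ pointwise (λ n → collect ((one ⊕ ((e ⊕ e′) ⊕ (e ⊕ e′))) n) ((e ⊛ e′) n) ((a ⊛ y) n) ((x ⊛ g) n)) ⟩
  one ⊕ ((e ⊕ e′) ⊕ (e ⊕ e′)) ⊕ quadruple (x ⊛ g ⊕ a ⊛ y ⊕ e ⊛ e′)                  ∎)
  where
  open SetoidReasoning setoid
  a = one ⊕ (e ⊕ e)
  a′ = one ⊕ (e′ ⊕ e′)
  expandʳ : ∀ a x g → (a ⊕ quadruple x) ⊛ g ≈ a ⊛ g ⊕ quadruple (x ⊛ g)
  expandʳ = SeriesSolver.solve 3 (λ a x g → (a :+ ((x :+ x) :+ (x :+ x))) :* g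
    := a :* g :+ ((x :* g :+ x :* g) :+ (x :* g :+ x :* g))) ≈-refl
  expandˡ : ∀ a b y → a ⊛ (b ⊕ quadruple y) ≈ a ⊛ b ⊕ quadruple (a ⊛ y)
  expandˡ = SeriesSolver.solve 3 (λ a b y → a :* (b :+ ((y :+ y) :+ (y :+ y)))
    := a :* b :+ ((a :* y :+ a :* y) :+ (a :* y :+ a :* y))) ≈-refl
  expand : ∀ e d → (one ⊕ (e ⊕ e)) ⊛ (one ⊕ (d ⊕ d)) ≈ one ⊕ ((e ⊕ d) ⊕ (e ⊕ d)) ⊕ quadruple (e ⊛ d)
  expand = SeriesSolver.solve 2 (λ e d → (con 1 :+ (e :+ e)) :* (con 1 :+ (d :+ d))
    := con 1 :+ ((e :+ d) :+ (e :+ d)) :+ ((e :* d :+ e :* d) :+ (e :* d :+ e :* d))) ≈-refl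
  collect : ∀ s u v w → s + (u + u + (u + u)) + (v + v + (v + v)) + (w + w + (w + w))
          ≡ s + (w + v + u + (w + v + u) + (w + v + u + (w + v + u)))
  collect = solve-∀

mod4-respˡ-≈ : ∀ {f g e} → f ≈ g → g ≡1+2 e mod4 → f ≡1+2 e mod4
mod4-respˡ-≈ f≈g (x , g≈) = x , ≈-trans f≈g g≈

mod4-one : one ≡1+2 𝟘 mod4
mod4-one = 𝟘 , pointwise λ n → sym (trans (ℤₚ.+-identityʳ _) (ℤₚ.+-identityʳ _))

binom-sum : ∀ k n → binom 1ℤ k n + binom -1ℤ k n ≡ one n + one n
binom-sum k zero = refl
binom-sum k (suc n) with suc n ≡ᵇ k
... | true  = refl
... | false = refl

-- From f + f′ = 2 and f′ v = 1 follows f v = 2 v - 1 = 1 + 2 (v - 1). The equality is exact, whence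
-- the quotient `𝟘`.
binom⊛inverse-mod4 : ∀ f f′ v → (∀ n → f n + f′ n ≡ one n + one n) → f′ ⊛ v ≈ one →
                     f ⊛ v ≡1+2 v ⊕ ⊖ one mod4
binom⊛inverse-mod4 f f′ v f+f′≡2 f′v≈1 = 𝟘 , pointwise λ n → lemma ((f ⊛ v) n) ((f′ ⊛ v) n) (v n) (one n)
  (trans (sym (⊛-distribʳ v f f′ .at n))
    (trans (⊛-congʳ v {f ⊕ f′} {one ⊕ one} (pointwise f+f′≡2) .at n)
    (trans (⊛-distribʳ v one one .at n) (cong (λ x → x + x) (⊛-identityˡ v .at n)))))
  (f′v≈1 .at n)
  where
  lemma : ∀ a b g o → a + b ≡ g + g → b ≡ o → a ≡ o + (g + - o + (g + - o)) + (0ℤ + 0ℤ + (0ℤ + 0ℤ))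
  lemma a b g o p refl = trans (step₁ a b) (trans (cong (_- b) p) (step₂ g b))
    where
    step₁ : ∀ a b → a ≡ a + b - b
    step₁ = solve-∀
    step₂ : ∀ g o → g + g - o ≡ o + (g + - o + (g + - o)) + (0ℤ + 0ℤ + (0ℤ + 0ℤ))
    step₂ = solve-∀

halfFactor : ℕ → ℕ → Series
halfFactor k l = geo k ⊕ ⊖ one ⊕ (altGeo l ⊕ ⊖ one)

-- Regrouping as (1 + q^K) / (1 - q^K) times (1 - q^L) / (1 + q^L) makes `binom⊛inverse-mod4` apply
-- to each quotient.
factorOf-mod4 : ∀ k l → factorOf k l ≡1+2 halfFactor k l mod4
factorOf-mod4 k l = mod4-respˡ-≈ (rearrange (binom 1ℤ (suc k)) (binom -1ℤ (suc l)) (geo k) (altGeo l)) (⊛-mod4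
  (binom⊛inverse-mod4 (binom 1ℤ (suc k)) (binom -1ℤ (suc k)) (geo k) (binom-sum (suc k)) (binom-geo k))
  (binom⊛inverse-mod4 (binom -1ℤ (suc l)) (binom 1ℤ (suc l)) (altGeo l)
    (λ n → trans (ℤₚ.+-comm (binom -1ℤ (suc l) n) (binom 1ℤ (suc l) n)) (binom-sum (suc l) n)) (binom-altGeo l)))
  where
  rearrange : ∀ b c g a → b ⊛ c ⊛ g ⊛ a ≈ (b ⊛ g) ⊛ (c ⊛ a)
  rearrange = SeriesSolver.solve 4 (λ b c g a → b :* c :* g :* a := (b :* g) :* (c :* a)) ≈-refl

-- The product over odd exponents

odd : ℕ → ℕ
odd j = suc (2 ℕ.* j)

odd-∤ : ∀ j → ¬ 2 ℕ∣.∣ odd j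
odd-∤ j 2∣odd = toWitnessFalse {a? = 2 ∣? 1} _
  (ℕ∣.∣m+n∣m⇒∣n (subst (2 ℕ∣.∣_) (ℕₚ.+-comm 1 (2 ℕ.* j)) 2∣odd) (ℕ∣.m∣m*n j))

9*odd-∤ : ∀ j → ¬ 2 ℕ∣.∣ 9 ℕ.* odd j
9*odd-∤ j 2∣9*odd = toWitnessFalse {a? = 2 ∣? 9} _ (2∣m*odd⇒2∣m (odd-∤ j) 2∣9*odd)

logDerivative-prodFactors : ∀ J → LogDerivative (prodFactors J) (λ n → ∑ J (λ j → logFactor (2 ℕ.* j) (9 ℕ.* odd j ∸ 1) n))
logDerivative-prodFactors zero    = logDerivative-one
logDerivative-prodFactors (suc J) =
  -- `9 ℕ.* odd J` reduces to a successor, so `factor J` is definitionally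
  -- `factorOf (2 ℕ.* J) (9 ℕ.* odd J ∸ 1)`.
  logDerivative-⊛ (prodFactors J) (factor J) (logDerivative-prodFactors J) (logDerivative-factorOf (2 ℕ.* J) (9 ℕ.* odd J ∸ 1))

prodFactors-mod4 : ∀ J → prodFactors J ≡1+2 (λ n → ∑ J (λ j → halfFactor (2 ℕ.* j) (9 ℕ.* odd j ∸ 1) n)) mod4
prodFactors-mod4 zero    = mod4-one
prodFactors-mod4 (suc J) = ⊛-mod4 (prodFactors-mod4 J) (factorOf-mod4 (2 ℕ.* J) (9 ℕ.* odd J ∸ 1))

prodFactors-0 : ∀ J → prodFactors J 0 ≡ 1ℤ
prodFactors-0 zero    = refl
prodFactors-0 (suc J) = trans (ℤₚ.*-identityʳ _) (prodFactors-0 J)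

mod4⇒∣2 : ∀ {f e n} → f ≡1+2 e mod4 → 0 < n → + 2 ∣ f n
mod4⇒∣2 {e = e} {suc n} (x , f≈) _ =
  divides (e (suc n) + (x (suc n) + x (suc n))) (trans (f≈ .at (suc n)) (lemma (e (suc n)) (x (suc n))))
  where
  lemma : ∀ e x → 0ℤ + (e + e) + (x + x + (x + x)) ≡ (e + (x + x)) * + 2
  lemma = solve-∀

mod4⇒∣4 : ∀ {f e n} → f ≡1+2 e mod4 → 0 < n → + 2 ∣ e n → + 4 ∣ f n
mod4⇒∣4 {n = suc n} (x , f≈) _ (divides q eq) = divides (q + x (suc n)) (trans (f≈ .at (suc n))
  (trans (cong (λ e → 0ℤ + (e + e) + (x (suc n) + x (suc n) + (x (suc n) + x (suc n)))) eq) (lemma q (x (suc n)))))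
  where
  lemma : ∀ q x → 0ℤ + (q * + 2 + q * + 2) + (x + x + (x + x)) ≡ (q + x) * + 4
  lemma = solve-∀

-- Signs are invisible modulo 2, so `altGeo` may be replaced by `geo`; the constants disappear
-- because `n` is positive.
halfFactor-mod2 : ∀ k l {n} → 0 < n → + 2 ∣ halfFactor k l n - (ind (suc k ∣? n) + ind (suc l ∣? n))
halfFactor-mod2 k l {n@(suc _)} _ = subst (+ 2 ∣_) (trans (lemma (geo k n) (geo l n) (altGeo l n))
  (cong₂ (λ x y → halfFactor k l n - (x + y)) (geo-ind k n) (geo-ind l n))) (altGeo-geo-mod2 l n)
  where
  lemma : ∀ g h a → a - h ≡ g + - 0ℤ + (a + - 0ℤ) - (g + h)
  lemma = solve-∀

-- Sums over odd numbers, sorted by divisibility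

ind-⇔ : ∀ {P Q : Set} (P? : Dec P) (Q? : Dec Q) → (P → Q) → (Q → P) → ind P? ≡ ind Q?
ind-⇔ (yes p) Q? P→Q _ = sym (ind-yes Q? (P→Q p))
ind-⇔ (no ¬p) Q? _ Q→P = sym (ind-no Q? (¬p ∘ Q→P))

∑-extend : ∀ {m n f} → m ≤ n → (∀ i → m ≤ i → f i ≡ 0ℤ) → ∑ n f ≡ ∑ m f
∑-extend {m} {n} {f} m≤n f≗0 = begin
  ∑ n f                                        ≡⟨ cong (λ l → ∑ l f) (ℕₚ.m∸n+n≡m m≤n) ⟨
  ∑ (n ∸ m ℕ.+ m) f                            ≡⟨ ∑-append m (n ∸ m) f ⟩
  ∑ m f + ∑ (n ∸ m) (λ i → f (i ℕ.+ m))        ≡⟨ cong (_+_ (∑ m f)) (∑-0 (n ∸ m) λ i _ → f≗0 (i ℕ.+ m) (ℕₚ.m≤n+m m i)) ⟩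
  ∑ m f + 0ℤ                                   ≡⟨ ℤₚ.+-identityʳ _ ⟩
  ∑ m f                                        ∎
  where open ≡-Reasoning

∑-blocks : ∀ m n f → ∑ (m ℕ.* n) f ≡ ∑ m (λ i → ∑ n (λ r → f (r ℕ.+ i ℕ.* n)))
∑-blocks zero    n f = refl
∑-blocks (suc m) n f = trans (∑-append (m ℕ.* n) n f) (cong (_+ ∑ n (λ r → f (r ℕ.+ m ℕ.* n))) (∑-blocks m n f))

∑odd : ℕ → (ℕ → ℤ) → ℤ
∑odd J f = ∑ J (λ j → f (odd j))

odd-* : ∀ h i → odd (h ℕ.+ i ℕ.* odd h) ≡ odd h ℕ.* odd i
odd-* = lemma
  where
  lemma : ∀ h i → suc (2 ℕ.* (h ℕ.+ i ℕ.* suc (2 ℕ.* h))) ≡ suc (2 ℕ.* h) ℕ.* suc (2 ℕ.* i)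
  lemma = ℕ-RingSolver.solve-∀

odd-mono-≤ : ∀ {i j} → i ≤ j → odd i ≤ odd j
odd-mono-≤ i≤j = s≤s (ℕₚ.*-monoʳ-≤ 2 i≤j)

odd-injective : ∀ {i j} → odd i ≡ odd j → i ≡ j
odd-injective {i} {j} eq = ℕₚ.*-cancelˡ-≡ i j 2 (ℕₚ.suc-injective eq)

¬2∣⇒odd : ∀ n → ¬ 2 ℕ∣.∣ n → ∃[ j ] n ≡ odd j
¬2∣⇒odd zero          2∤n = contradiction (ℕ∣.divides 0 refl) 2∤n
¬2∣⇒odd (suc zero)    2∤n = 0 , refl
¬2∣⇒odd (suc (suc n)) 2∤n with ¬2∣⇒odd n (2∤n ∘ ℕ∣.∣m∣n⇒∣m+n (ℕ∣.∣-refl {2}))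
... | j , refl = suc j , cong (suc ∘ suc) (sym (ℕₚ.+-suc j (j ℕ.+ 0)))

-- Modulo p = `odd h` the block offset disappears, so p divides `odd r`. Being positive and below 2
-- p, `odd r` then equals p.
odd∣odd-small : ∀ {h r i} → r < odd h → odd h ℕ∣.∣ odd (r ℕ.+ i ℕ.* odd h) → r ≡ h
odd∣odd-small {h} {r} {i} r<p p∣ with ℕ∣.∣m+n∣m⇒∣n {n = odd r} (subst (odd h ℕ∣.∣_) (lemma r i (odd h)) p∣) (ℕ∣.m∣m*n (2 ℕ.* i))
  where
  lemma : ∀ r i p → suc (2 ℕ.* (r ℕ.+ i ℕ.* p)) ≡ p ℕ.* (2 ℕ.* i) ℕ.+ suc (2 ℕ.* r)
  lemma = ℕ-RingSolver.solve-∀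
... | ℕ∣.divides (suc zero) eq = odd-injective (trans eq (ℕₚ.+-identityʳ (odd h)))
... | ℕ∣.divides (suc (suc q)) eq = contradiction (begin-strict
  odd r                       <⟨ ℕₚ.n<1+n (odd r) ⟩
  suc (odd r)                 ≡⟨ ℕₚ.*-suc 2 r ⟨
  2 ℕ.* suc r                 ≤⟨ ℕₚ.*-mono-≤ {2} {suc (suc q)} (s≤s (s≤s z≤n)) r<p ⟩
  suc (suc q) ℕ.* odd h       ≡⟨ eq ⟨
  odd r                       ∎) (ℕₚ.<-irrefl refl)
  where open ℕₚ.≤-Reasoning

restrictTo : ℕ → (ℕ → ℤ) → ℕ → ℤ
restrictTo p f k = ind (p ∣? k) * f k

restrictAway : ℕ → (ℕ → ℤ) → ℕ → ℤ
restrictAway p f k = (1ℤ - ind (p ∣? k)) * f k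

-- The range is extended to J p indices, `f` being zero on the new ones, and cut into J blocks of
-- length p = `odd h`. The i-th block contributes its only multiple of p, which is p times `odd i`
-- and sits at position h.
∑odd-restrictTo : ∀ h {J} f → (∀ j → J ≤ j → f (odd j) ≡ 0ℤ) →
                  ∑odd J (restrictTo (odd h) f) ≡ ∑odd J (λ k → f (odd h ℕ.* k))
∑odd-restrictTo h {J} f f≗0 = begin
  ∑ J g                                           ≡⟨ ∑-extend (ℕₚ.m≤m*n J p) (λ j J≤j → trans
                                                     (cong (_*_ (ind (p ∣? odd j))) (f≗0 j J≤j)) (ℤₚ.*-zeroʳ (ind (p ∣? odd j)))) ⟨
  ∑ (J ℕ.* p) g                                   ≡⟨ ∑-blocks J p g ⟩
  ∑ J (λ i → ∑ p (λ r → g (r ℕ.+ i ℕ.* p)))       ≡⟨ ∑-cong J (λ i _ → block i) ⟩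
  ∑odd J (λ k → f (p ℕ.* k))                      ∎
  where
  open ≡-Reasoning
  p = odd h
  g : ℕ → ℤ
  g j = restrictTo p f (odd j)
  block : ∀ i → ∑ p (λ r → g (r ℕ.+ i ℕ.* p)) ≡ f (p ℕ.* odd i)
  block i = begin
    ∑ p (λ r → g (r ℕ.+ i ℕ.* p))             ≡⟨ ∑-single p h (s≤s (ℕₚ.m≤n*m h 2)) (λ r r<p r≢h →
                                                 cong (_* f (odd (r ℕ.+ i ℕ.* p))) (ind-no (p ∣? _) (r≢h ∘ odd∣odd-small {i = i} r<p))) ⟩
    restrictTo p f (odd (h ℕ.+ i ℕ.* p))      ≡⟨ cong (restrictTo p f) (odd-* h i) ⟩
    restrictTo p f (p ℕ.* odd i)              ≡⟨ cong (_* f (p ℕ.* odd i)) (ind-yes (p ∣? p ℕ.* odd i) (ℕ∣.m∣m*n (odd i))) ⟩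
    1ℤ * f (p ℕ.* odd i)                      ≡⟨ ℤₚ.*-identityˡ _ ⟩
    f (p ℕ.* odd i)                           ∎

∑odd-split : ∀ h {J} f → (∀ j → J ≤ j → f (odd j) ≡ 0ℤ) →
             ∑odd J f ≡ ∑odd J (λ k → f (odd h ℕ.* k)) + ∑odd J (restrictAway (odd h) f)
∑odd-split h {J} f f≗0 = begin
  ∑odd J f                                                              ≡⟨ ∑-cong J (λ j _ → lemma (ind (odd h ∣? odd j)) (f (odd j))) ⟩
  ∑odd J (λ k → restrictTo (odd h) f k + restrictAway (odd h) f k)      ≡⟨ ∑-distrib-+ J _ _ ⟩
  ∑odd J (restrictTo (odd h) f) + ∑odd J (restrictAway (odd h) f)       ≡⟨ cong (_+ ∑odd J (restrictAway (odd h) f)) (∑odd-restrictTo h f f≗0) ⟩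
  ∑odd J (λ k → f (odd h ℕ.* k)) + ∑odd J (restrictAway (odd h) f)      ∎
  where
  open ≡-Reasoning
  lemma : ∀ i x → x ≡ i * x + (1ℤ - i) * x
  lemma = solve-∀

restrictAway-∣ : ∀ {p k} f → p ℕ∣.∣ k → restrictAway p f k ≡ 0ℤ
restrictAway-∣ {p} {k} f p∣k = cong (λ x → (1ℤ - x) * f k) (ind-yes (p ∣? k) p∣k)

restrictAway-∤ : ∀ {p k} f → ¬ p ℕ∣.∣ k → restrictAway p f k ≡ f k
restrictAway-∤ {p} {k} f p∤k = trans (cong (λ x → (1ℤ - x) * f k) (ind-no (p ∣? k) p∤k)) (ℤₚ.*-identityˡ (f k))

restrictAway-cong : ∀ p f g → (∀ k → ¬ p ℕ∣.∣ k → f k ≡ g k) → ∀ k → restrictAway p f k ≡ restrictAway p g k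
restrictAway-cong p f g f≗g k with p ∣? k
... | yes _   = refl
... | no p∤k = cong (_*_ (1ℤ - 0ℤ)) (f≗g k p∤k)

-- Parity of the number and of the sum of odd divisors

ind-∣-large : ∀ {k n} → 0 < n → n < k → ind (k ∣? n) ≡ 0ℤ
ind-∣-large {k} {n@(suc _)} _ n<k = ind-no (k ∣? n) λ k∣n → ℕₚ.<⇒≱ n<k (ℕ∣.∣⇒≤ k∣n)

prime∤⇒∣ : ∀ {p k n} → Prime p → ¬ p ℕ∣.∣ k → k ℕ∣.∣ p ℕ.* n → k ℕ∣.∣ n
prime∤⇒∣ {p} {k} {n} p-prime p∤k (ℕ∣.divides q eq) with euclidsLemma q k p-prime (subst (p ℕ∣.∣_) eq (ℕ∣.m∣m*n n))
... | inj₂ p∣k = contradiction p∣k p∤k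
... | inj₁ (ℕ∣.divides r refl) = ℕ∣.divides r (ℕₚ.*-cancelˡ-≡ n (r ℕ.* k) p {{prime⇒nonZero p-prime}} (trans eq (lemma r p k)))
  where
  lemma : ∀ r p k → r ℕ.* p ℕ.* k ≡ p ℕ.* (r ℕ.* k)
  lemma = ℕ-RingSolver.solve-∀

prime[3] : Prime 3
prime[3] = toWitness {a? = prime? 3} _

<odd : ∀ {n J} → n ≤ J → n < odd J
<odd {n} {J} n≤J = s≤s (ℕₚ.≤-trans n≤J (ℕₚ.m≤n*m J 2))

-- Splitting off the multiples of 3 = `odd 1` twice gives ∑ d₁ = s₉ + r + r: for 3 ∤ k and 3 ∣ n, k
-- divides n exactly when 3 k does, so both splittings leave the same remainder r. Adding s₉ yields
-- 2 (s₉ + r).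
∑odd-ind-even : ∀ {n J} → 0 < n → n ≤ J → 3 ℕ∣.∣ n →
                + 2 ∣ ∑odd J (λ k → ind (k ∣? n) + ind (9 ℕ.* k ∣? n))
∑odd-ind-even {n} {J} 0<n n≤J 3∣n = divides (s₉ + r) (begin
  ∑odd J (λ k → d₁ k + d₉ k)     ≡⟨ ∑-distrib-+ J _ _ ⟩
  ∑odd J d₁ + s₉                 ≡⟨ cong (_+ s₉) (∑odd-split 1 d₁ vanish₁) ⟩
  ∑odd J d₃ + r + s₉             ≡⟨ cong (λ x → x + r + s₉) (∑odd-split 1 d₃ vanish₃) ⟩
  ∑odd J (λ k → d₃ (3 ℕ.* k)) + ∑odd J (restrictAway 3 d₃) + r + s₉
    ≡⟨ cong₂ (λ x y → x + y + r + s₉)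
        (∑-cong J λ j _ → ind-⇔ (3 ℕ.* (3 ℕ.* odd j) ∣? n) (9 ℕ.* odd j ∣? n)
          (subst (ℕ∣._∣ n) (sym (ℕₚ.*-assoc 3 3 (odd j)))) (subst (ℕ∣._∣ n) (ℕₚ.*-assoc 3 3 (odd j))))
        (∑-cong J λ j _ → restrictAway-cong 3 d₃ d₁ d₃≗d₁ (odd j)) ⟩
  s₉ + r + r + s₉                ≡⟨ lemma s₉ r ⟩
  (s₉ + r) * + 2                 ∎)
  where
  open ≡-Reasoning
  d₁ d₃ d₉ : ℕ → ℤ
  d₁ k = ind (k ∣? n)
  d₃ k = ind (3 ℕ.* k ∣? n)
  d₉ k = ind (9 ℕ.* k ∣? n)
  s₉ = ∑odd J d₉
  r = ∑odd J (restrictAway 3 d₁)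
  vanish₁ : ∀ j → J ≤ j → d₁ (odd j) ≡ 0ℤ
  vanish₁ j J≤j = ind-∣-large 0<n (ℕₚ.<-≤-trans (<odd n≤J) (odd-mono-≤ J≤j))
  vanish₃ : ∀ j → J ≤ j → d₃ (odd j) ≡ 0ℤ
  vanish₃ j J≤j = ind-∣-large 0<n (ℕₚ.<-≤-trans (<odd n≤J) (ℕₚ.≤-trans (odd-mono-≤ J≤j) (ℕₚ.m≤n*m (odd j) 3)))
  d₃≗d₁ : ∀ k → ¬ 3 ℕ∣.∣ k → d₃ k ≡ d₁ k
  d₃≗d₁ k 3∤k = ind-⇔ (3 ℕ.* k ∣? n) (k ∣? n) (ℕ∣.∣-trans (ℕ∣.divides 3 refl)) λ k∣n → 3k∣n k∣n 3∣n
    where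
    3k∣n : k ℕ∣.∣ n → 3 ℕ∣.∣ n → 3 ℕ.* k ℕ∣.∣ n
    3k∣n k∣n (ℕ∣.divides q refl) = subst (3 ℕ.* k ℕ∣.∣_) (ℕₚ.*-comm 3 q)
      (ℕ∣.*-monoʳ-∣ 3 (prime∤⇒∣ {n = q} prime[3] 3∤k (subst (k ℕ∣.∣_) (ℕₚ.*-comm q 3) k∣n)))
  lemma : ∀ s r → s + r + r + s ≡ (s + r) * + 2
  lemma = solve-∀

-- The pairs (a, b) and (b, a) contribute equally. In the induction, the new row and column agree
-- and the new corner is zero.
∑∑-symmetric-even : ∀ J (F : ℕ → ℕ → ℤ) → (∀ a b → F a b ≡ F b a) → (∀ a → F a a ≡ 0ℤ) →
                    + 2 ∣ ∑ J (λ a → ∑ J (F a))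
∑∑-symmetric-even zero    F _       _    = divides 0ℤ refl
∑∑-symmetric-even (suc J) F F-sym F-diag = subst (+ 2 ∣_) (sym (begin
  ∑ J (λ a → ∑ J (F a) + F a J) + (∑ J (F J) + F J J)
    ≡⟨ cong₂ _+_ (∑-distrib-+ J (λ a → ∑ J (F a)) (λ a → F a J)) (cong (_+_ (∑ J (F J))) (F-diag J)) ⟩
  s + ∑ J (λ a → F a J) + (∑ J (F J) + 0ℤ)
    ≡⟨ cong (λ x → s + x + (∑ J (F J) + 0ℤ)) (∑-cong J λ a _ → F-sym a J) ⟩
  s + ∑ J (F J) + (∑ J (F J) + 0ℤ)
    ≡⟨ lemma s (∑ J (F J)) ⟩
  s + ∑ J (F J) * + 2 ∎)) (∣m∣n⇒∣m+n (∑∑-symmetric-even J F F-sym F-diag) (divides (∑ J (F J)) refl))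
  where
  open ≡-Reasoning
  s = ∑ J (λ a → ∑ J (F a))
  lemma : ∀ s t → s + t + (t + 0ℤ) ≡ s + t * + 2
  lemma = solve-∀

square-mod3 : ∀ a → a ℕ.* a % 3 ≢ 2
square-mod3 a eq = go (a % 3) (ℕ/.m%n<n a 3) (trans (sym (ℕ/.%-distribˡ-* a a 3)) eq)
  where
  go : ∀ r → r < 3 → r ℕ.* r % 3 ≢ 2
  go 0 _ ()
  go 1 _ ()
  go 2 _ ()
  go (suc (suc (suc _))) (s≤s (s≤s (s≤s ())))

-- Counting cofactors turns the number of divisors into a double sum symmetric in a and b. The
-- cofactor is odd because n is, and n ≤ J keeps its index in range.
odd-divisor-cofactor : ∀ {n J} a → ¬ 2 ℕ∣.∣ n → n ≤ J →
                       ∑ J (λ b → ind (odd a ℕ.* odd b ℕ.≟ n)) ≡ ind (odd a ∣? n)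
odd-divisor-cofactor {n} {J} a 2∤n n≤J with odd a ∣? n
... | no a∤n = trans
  (∑-0 J λ b _ → ind-no (odd a ℕ.* odd b ℕ.≟ n) λ eq → a∤n (subst (odd a ℕ∣.∣_) eq (ℕ∣.m∣m*n (odd b))))
  (sym (ind-no (odd a ∣? n) a∤n))
... | yes a∣n@(ℕ∣.divides q refl) with ¬2∣⇒odd q (2∤n ∘ ℕ∣.∣m⇒∣m*n (odd a))
...   | b , refl = trans
  (∑-single J b b<J λ c _ c≢b → ind-no (odd a ℕ.* odd c ℕ.≟ n) λ eq →
    c≢b (odd-injective (ℕₚ.*-cancelˡ-≡ (odd c) (odd b) (odd a) (trans eq (ℕₚ.*-comm (odd b) (odd a))))))
  (trans (ind-yes (odd a ℕ.* odd b ℕ.≟ n) (ℕₚ.*-comm (odd a) (odd b))) (sym (ind-yes (odd a ∣? n) a∣n)))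
  where
  b<J : b < J
  b<J = ℕₚ.≤-trans (s≤s (ℕₚ.m≤n*m b 2)) (ℕₚ.≤-trans (ℕₚ.m≤m*n (odd b) (odd a)) n≤J)

-- Exchanging a divisor with its cofactor has no fixed point, since a number ≡ 2 (mod 3) is not a
-- square.
odd-divisors-even : ∀ {n J} → ¬ 2 ℕ∣.∣ n → n % 3 ≡ 2 → n ≤ J → + 2 ∣ ∑odd J (λ k → ind (k ∣? n))
odd-divisors-even {n} {J} 2∤n n%3≡2 n≤J = subst (+ 2 ∣_) (∑-cong J λ a _ → odd-divisor-cofactor a 2∤n n≤J)
  (∑∑-symmetric-even J (λ a b → ind (odd a ℕ.* odd b ℕ.≟ n))
    (λ a b → ind-⇔ (odd a ℕ.* odd b ℕ.≟ n) (odd b ℕ.* odd a ℕ.≟ n)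
      (trans (ℕₚ.*-comm (odd b) (odd a))) (trans (ℕₚ.*-comm (odd a) (odd b))))
    (λ a → ind-no (odd a ℕ.* odd a ℕ.≟ n) λ eq → square-mod3 (odd a) (trans (cong (_% 3) eq) n%3≡2)))

-- The weight k = 1 + 2 j changes each term by an even amount.
∑odd-weighted-even : ∀ {J f} → + 2 ∣ ∑odd J f → + 2 ∣ ∑odd J (λ k → + k * f k)
∑odd-weighted-even {J} {f} 2∣∑f = subst (+ 2 ∣_) (trans (sym (∑-distrib-+ J _ _)) (∑-cong J λ j _ → lemma j (f (odd j))))
  (∣m∣n⇒∣m+n 2∣∑f (∑-∣ J λ j _ → divides (+ j * f (odd j)) refl))
  where
  lemma : ∀ j x → x + + j * x * + 2 ≡ + odd j * x
  lemma j x = trans (ring (+ j) x) (cong (_* x) (cong (_+_ 1ℤ) (sym (ℤₚ.pos-* 2 j))))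
    where
    ring : ∀ j x → x + j * x * + 2 ≡ (1ℤ + + 2 * j) * x
    ring = solve-∀

-- For odd n with n ≤ J this is the usual sum of divisors. The range `J` is kept apart from `n`, so
-- that values at different n can be related under a single bound.
σ : ℕ → ℕ → ℤ
σ J n = ∑odd J (λ k → + k * ind (k ∣? n))

-- The sum of divisors of p^a m

∣prime^*⇒∣ : ∀ {p k} → Prime p → ¬ p ℕ∣.∣ k → ∀ a m → k ℕ∣.∣ p ℕ.^ a ℕ.* m → k ℕ∣.∣ m
∣prime^*⇒∣ {k = k} p-prime p∤k zero m k∣ = subst (k ℕ∣.∣_) (ℕₚ.*-identityˡ m) k∣
∣prime^*⇒∣ {p} {k} p-prime p∤k (suc a) m k∣ = ∣prime^*⇒∣ p-prime p∤k a m
  (prime∤⇒∣ p-prime p∤k (subst (k ℕ∣.∣_) (ℕₚ.*-assoc p (p ℕ.^ a) m) k∣))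

-- Among the odd divisors of p^(a+1) m, the multiples of p are p times those of p^a m, and the
-- others are those of m.
σ-prime^ : ∀ h {J m} a → let p = odd h in Prime p → 0 < m → ¬ p ℕ∣.∣ m → p ℕ.^ suc a ℕ.* m ≤ J →
           σ J (p ℕ.^ suc a ℕ.* m) ≡ + p * σ J (p ℕ.^ a ℕ.* m) + σ J m
σ-prime^ h {J} {m} a p-prime 0<m p∤m n≤J = begin
  σ J n                                                             ≡⟨ ∑odd-split h (λ k → + k * ind (k ∣? n)) vanish ⟩
  ∑odd J (λ k → + (p ℕ.* k) * ind (p ℕ.* k ∣? n)) + ∑odd J (restrictAway p (λ k → + k * ind (k ∣? n)))
    ≡⟨ cong₂ _+_ (trans (∑-cong J λ j _ → divisible (odd j)) (sym (*-distribˡ-∑ J (+ p) (λ j → + odd j * ind (odd j ∣? n′)))))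
                 (∑-cong J λ j _ → indivisible (odd j)) ⟩
  + p * σ J n′ + σ J m                                              ∎
  where
  open ≡-Reasoning
  p = odd h
  n = p ℕ.^ suc a ℕ.* m
  n′ = p ℕ.^ a ℕ.* m
  0<n : 0 < n
  0<n = ℕₚ.*-mono-≤ {1} {p ℕ.^ suc a} (ℕₚ.m^n>0 p (suc a)) 0<m
  n≡p*n′ : n ≡ p ℕ.* n′
  n≡p*n′ = ℕₚ.*-assoc p (p ℕ.^ a) m
  vanish : ∀ j → J ≤ j → + odd j * ind (odd j ∣? n) ≡ 0ℤ
  vanish j J≤j = trans (cong (_*_ (+ odd j)) (ind-∣-large 0<n (ℕₚ.<-≤-trans (<odd n≤J) (odd-mono-≤ J≤j)))) (ℤₚ.*-zeroʳ (+ odd j))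
  divisible : ∀ k → + (p ℕ.* k) * ind (p ℕ.* k ∣? n) ≡ + p * (+ k * ind (k ∣? n′))
  divisible k = trans (cong₂ _*_ (ℤₚ.pos-* p k) (ind-⇔ (p ℕ.* k ∣? n) (k ∣? n′)
    (λ pk∣n → ℕ∣.*-cancelˡ-∣ p (subst (p ℕ.* k ℕ∣.∣_) n≡p*n′ pk∣n))
    (λ k∣n′ → subst (p ℕ.* k ℕ∣.∣_) (sym n≡p*n′) (ℕ∣.*-monoʳ-∣ p k∣n′)))) (ℤₚ.*-assoc (+ p) (+ k) _)
  indivisible : ∀ k → restrictAway p (λ k → + k * ind (k ∣? n)) k ≡ + k * ind (k ∣? m)
  indivisible k with p ∣? k
  ... | yes p∣k = trans (restrictAway-∣ (λ k → + k * ind (k ∣? n)) p∣k)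
    (sym (trans (cong (_*_ (+ k)) (ind-no (k ∣? m) (p∤m ∘ ℕ∣.∣-trans p∣k))) (ℤₚ.*-zeroʳ (+ k))))
  ... | no p∤k = trans (restrictAway-∤ (λ k → + k * ind (k ∣? n)) p∤k) (cong (_*_ (+ k)) (ind-⇔ (k ∣? n) (k ∣? m)
        (∣prime^*⇒∣ p-prime p∤k (suc a) m) (ℕ∣.∣n⇒∣m*n (p ℕ.^ suc a))))

-- Cube roots of unity modulo p, and p modulo 3

∑-swap : ∀ m n (f : ℕ → ℕ → ℤ) → ∑ m (λ i → ∑ n (f i)) ≡ ∑ n (λ j → ∑ m (λ i → f i j))
∑-swap zero    n f = sym (∑-0 n λ _ _ → refl)
∑-swap (suc m) n f = trans (cong (_+ ∑ n (f m)) (∑-swap m n f)) (sym (∑-distrib-+ n _ (f m)))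

-- Off the diagonal, rotation has orbits of three triples. Enlarging the cube by one adds three
-- equal faces, three equal edges and a corner that vanishes.
∑∑∑-cyclic-∣3 : ∀ J (F : ℕ → ℕ → ℕ → ℤ) → (∀ a b c → F a b c ≡ F b c a) → (∀ a → F a a a ≡ 0ℤ) →
                + 3 ∣ ∑ J (λ a → ∑ J (λ b → ∑ J (F a b)))
∑∑∑-cyclic-∣3 zero    F _     _      = divides 0ℤ refl
∑∑∑-cyclic-∣3 (suc J) F cycle F-diag = subst (+ 3 ∣_) (sym (begin
  ∑ J (λ a → ∑ J (λ b → ∑ J (F a b) + F a b J) + (∑ J (F a J) + F a J J))
    + (∑ J (λ b → ∑ J (F J b) + F J b J) + (∑ J (F J J) + F J J J))
    ≡⟨ cong₂ _+_ faces edges ⟩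
  cube + face + (face + edge) + (face + edge + (edge + 0ℤ))
    ≡⟨ lemma cube face edge ⟩
  cube + (face + edge) * + 3 ∎)) (∣m∣n⇒∣m+n (∑∑∑-cyclic-∣3 J F cycle F-diag) (divides (face + edge) refl))
  where
  open ≡-Reasoning
  cube = ∑ J (λ a → ∑ J (λ b → ∑ J (F a b)))
  face = ∑ J (λ a → ∑ J (λ b → F a b J))
  edge = ∑ J (λ a → F a J J)
  faces : ∑ J (λ a → ∑ J (λ b → ∑ J (F a b) + F a b J) + (∑ J (F a J) + F a J J)) ≡ cube + face + (face + edge)
  faces = begin
    ∑ J (λ a → ∑ J (λ b → ∑ J (F a b) + F a b J) + (∑ J (F a J) + F a J J))
      ≡⟨ ∑-distrib-+ J (λ a → ∑ J (λ b → ∑ J (F a b) + F a b J)) (λ a → ∑ J (F a J) + F a J J) ⟩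
    ∑ J (λ a → ∑ J (λ b → ∑ J (F a b) + F a b J)) + ∑ J (λ a → ∑ J (F a J) + F a J J)
      ≡⟨ cong₂ _+_
          (trans (∑-cong J λ a _ → ∑-distrib-+ J (λ b → ∑ J (F a b)) (λ b → F a b J))
            (∑-distrib-+ J (λ a → ∑ J (λ b → ∑ J (F a b))) (λ a → ∑ J (λ b → F a b J))))
          (trans (∑-distrib-+ J (λ a → ∑ J (F a J)) (λ a → F a J J)) (cong (_+ edge)
            (trans (∑-cong J λ a _ → ∑-cong J λ c _ → sym (cycle c a J)) (∑-swap J J (λ a c → F c a J))))) ⟩
    cube + face + (face + edge) ∎
  edges : ∑ J (λ b → ∑ J (F J b) + F J b J) + (∑ J (F J J) + F J J J) ≡ face + edge + (edge + 0ℤ)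
  edges = cong₂ _+_
    (trans (∑-distrib-+ J (λ b → ∑ J (F J b)) (λ b → F J b J)) (cong₂ _+_
      (∑-cong J λ b _ → ∑-cong J λ c _ → cycle J b c)
      (∑-cong J λ b _ → cycle J b J)))
    (cong₂ _+_ (∑-cong J λ c _ → trans (cycle J J c) (cycle J c J)) (F-diag J))
  lemma : ∀ c f e → c + f + (f + e) + (f + e + (e + 0ℤ)) ≡ c + (f + e) * + 3
  lemma = solve-∀

module _ {p : ℕ} (p-prime : Prime p) where

  private instance
    p-nonZero : NonZero p
    p-nonZero = prime⇒nonZero p-prime

  p∤1 : ¬ p ℕ∣.∣ 1
  p∤1 p∣1 = ¬prime[1] (subst Prime (ℕ∣.∣1⇒≡1 p∣1) p-prime)

  coprime-prime : ∀ {m} → ¬ p ℕ∣.∣ m → Coprime m p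
  coprime-prime p∤m (d∣m , d∣p) with prime⇒irreducible p-prime d∣p
  ... | inj₁ d≡1  = d≡1
  ... | inj₂ refl = contradiction d∣m p∤m

  -- A Bézout identity for m and p provides -1 / m modulo p, which is then reduced below p.
  neg-inverse : ∀ {m} → ¬ p ℕ∣.∣ m → ∃[ b ] b < p × p ℕ∣.∣ suc (m ℕ.* b)
  neg-inverse {m} p∤m = reduce (go (coprime-Bézout (coprime-prime p∤m)))
    where
    go : Bézout.Identity 1 m p → ∃[ b ] p ℕ∣.∣ suc (m ℕ.* b)
    go (Bézout.-+ x y eq) = x , ℕ∣.divides y (trans (cong suc (ℕₚ.*-comm m x)) eq)
    -- Here x m ≡ 1 (mod p), so -x is wanted; x (p - 1) represents it.
    go (Bézout.+- x y eq) = x ℕ.* (p ∸ 1) , ℕ∣.divides (suc (y ℕ.* (p ∸ 1))) (begin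
      suc (m ℕ.* (x ℕ.* (p ∸ 1)))             ≡⟨ cong suc (lemma₁ m x (p ∸ 1)) ⟩
      suc (x ℕ.* m ℕ.* (p ∸ 1))               ≡⟨ cong (λ z → suc (z ℕ.* (p ∸ 1))) eq ⟨
      suc ((1 ℕ.+ y ℕ.* p) ℕ.* (p ∸ 1))       ≡⟨ lemma₂ y p (p ∸ 1) ⟩
      1 ℕ.+ (p ∸ 1) ℕ.+ y ℕ.* (p ∸ 1) ℕ.* p   ≡⟨ cong (ℕ._+ y ℕ.* (p ∸ 1) ℕ.* p) (ℕₚ.suc-pred p) ⟩
      p ℕ.+ y ℕ.* (p ∸ 1) ℕ.* p               ∎)
      where
      open ≡-Reasoning
      lemma₁ : ∀ m x r → m ℕ.* (x ℕ.* r) ≡ x ℕ.* m ℕ.* r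
      lemma₁ = ℕ-RingSolver.solve-∀
      lemma₂ : ∀ y p r → 1 ℕ.+ (1 ℕ.+ y ℕ.* p) ℕ.* r ≡ 1 ℕ.+ r ℕ.+ y ℕ.* r ℕ.* p
      lemma₂ = ℕ-RingSolver.solve-∀
    reduce : ∃[ b ] p ℕ∣.∣ suc (m ℕ.* b) → ∃[ b ] b < p × p ℕ∣.∣ suc (m ℕ.* b)
    reduce (b , p∣) = b % p , ℕ/.m%n<n b p , ℕ∣.∣m+n∣m⇒∣n
      (subst (p ℕ∣.∣_) (trans (cong (λ z → suc (m ℕ.* z)) (ℕ/.m≡m%n+[m/n]*n b p)) (lemma m (b % p) (b / p) p)) p∣)
      (ℕ∣.n∣m*n (m ℕ.* (b / p)))
      where
      lemma : ∀ m r q p → 1 ℕ.+ m ℕ.* (r ℕ.+ q ℕ.* p) ≡ m ℕ.* q ℕ.* p ℕ.+ (1 ℕ.+ m ℕ.* r)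
      lemma = ℕ-RingSolver.solve-∀

  -- Subtracting the two relations gives p ∣ m (c - b), and 0 ≤ c - b < p once b ≤ c may be assumed.
  neg-inverse-unique : ∀ {m b c} → ¬ p ℕ∣.∣ m → b < p → c < p → p ℕ∣.∣ suc (m ℕ.* b) → p ℕ∣.∣ suc (m ℕ.* c) → b ≡ c
  neg-inverse-unique {m} {b} {c} p∤m b<p c<p pb pc =
    Sum.[ (λ b≤c → ordered b≤c c<p pb pc) , (λ c≤b → sym (ordered c≤b b<p pc pb)) ]′ (ℕₚ.≤-total b c)
    where
    ordered : ∀ {b c} → b ≤ c → c < p → p ℕ∣.∣ suc (m ℕ.* b) → p ℕ∣.∣ suc (m ℕ.* c) → b ≡ c
    ordered {b} {c} b≤c c<p pb pc with euclidsLemma m (c ∸ b) p-prime (ℕ∣.∣m+n∣m⇒∣n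
      (subst (p ℕ∣.∣_) (trans (cong (λ z → suc (m ℕ.* z)) (sym (ℕₚ.m+[n∸m]≡n b≤c))) (cong suc (ℕₚ.*-distribˡ-+ m b (c ∸ b)))) pc) pb)
    ... | inj₁ p∣m = contradiction p∣m p∤m
    ... | inj₂ p∣c∸b with c ∸ b in eq
    ...   | zero  = ℕₚ.≤-antisym b≤c (ℕₚ.m∸n≡0⇒m≤n eq)
    ...   | suc d = contradiction (ℕₚ.≤-<-trans (ℕ∣.∣⇒≤ p∣c∸b) (ℕₚ.≤-<-trans (subst (_≤ c) eq (ℕₚ.m∸n≤m c b)) c<p)) (ℕₚ.<-irrefl refl)

  -- b = - 1 / (1 + a) modulo p: a permutation of order 3 of the projective line, with orbit {0, -1, ∞},
  -- whose fixed points are the primitive cube roots of unity.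
  Rotates : ℕ → ℕ → Set
  Rotates a b = p ℕ∣.∣ suc (suc a ℕ.* b)

  rotates? : ∀ a b → Dec (Rotates a b)
  rotates? a b = p ∣? suc (suc a ℕ.* b)

  -- (1 + a)(1 + (1 + b) c) = c (1 + (1 + a) b) + (1 + (1 + c) a), which is why the map has order 3.
  rotates-cycle : ∀ {a b c} → Rotates a b → Rotates b c → Rotates c a
  rotates-cycle {a} {b} {c} ab bc = ℕ∣.∣m+n∣m⇒∣n
    (subst (p ℕ∣.∣_) (lemma a b c) (ℕ∣.∣n⇒∣m*n (suc a) bc)) (ℕ∣.∣n⇒∣m*n c ab)
    where
    lemma : ∀ a b c → suc a ℕ.* suc (suc b ℕ.* c) ≡ c ℕ.* suc (suc a ℕ.* b) ℕ.+ suc (suc c ℕ.* a)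
    lemma = ℕ-RingSolver.solve-∀

  -- 0 goes to -1 and -1 to ∞: once p ∣ 1 + b, the number 1 + (1 + b) c is ≡ 1 (mod p) for every c.
  ¬rotates-0 : ∀ {b c} → Rotates 0 b → ¬ Rotates b c
  ¬rotates-0 {b} {c} 0b bc = p∤1 (ℕ∣.∣m+n∣m⇒∣n (subst (p ℕ∣.∣_) (lemma b c) bc) (ℕ∣.∣n⇒∣m*n c 0b))
    where
    lemma : ∀ b c → suc (suc b ℕ.* c) ≡ c ℕ.* suc (1 ℕ.* b) ℕ.+ 1
    lemma = ℕ-RingSolver.solve-∀

  -- For a = p - 1 the relation would read p ∣ 1 + p b.
  ¬rotates-∞ : ∀ {a b} → suc a ≡ p → ¬ Rotates a b
  ¬rotates-∞ {a} {b} refl ab = p∤1 (ℕ∣.∣m+n∣m⇒∣n (subst (p ℕ∣.∣_) (ℕₚ.+-comm 1 (p ℕ.* b)) ab) (ℕ∣.m∣m*n b))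

  -- Indicator of the closed path a ↦ b ↦ c ↦ a; listing all three arrows makes it invariant under
  -- rotation of the arguments.
  orbit : ℕ → ℕ → ℕ → ℤ
  orbit a b c = ind (rotates? a b) * ind (rotates? b c) * ind (rotates? c a)

  orbit-cycle : ∀ a b c → orbit a b c ≡ orbit b c a
  orbit-cycle a b c = lemma (ind (rotates? a b)) (ind (rotates? b c)) (ind (rotates? c a))
    where
    lemma : ∀ x y z → x * y * z ≡ y * z * x
    lemma = solve-∀

  orbit-yes : ∀ {a b c} → Rotates a b → Rotates b c → orbit a b c ≡ 1ℤ
  orbit-yes {a} {b} {c} ab bc = cong₂ _*_ (cong₂ _*_ (ind-yes (rotates? a b) ab) (ind-yes (rotates? b c) bc))
    (ind-yes (rotates? c a) (rotates-cycle {a} {b} {c} ab bc))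

  orbit-no₁ : ∀ {a b c} → ¬ Rotates a b → orbit a b c ≡ 0ℤ
  orbit-no₁ {a} {b} {c} ¬ab = cong (λ x → x * ind (rotates? b c) * ind (rotates? c a)) (ind-no (rotates? a b) ¬ab)

  orbit-no₂ : ∀ {a b c} → ¬ Rotates b c → orbit a b c ≡ 0ℤ
  orbit-no₂ {a} {b} {c} ¬bc = trans (cong (λ x → ind (rotates? a b) * x * ind (rotates? c a)) (ind-no (rotates? b c) ¬bc))
    (cong (_* ind (rotates? c a)) (ℤₚ.*-zeroʳ (ind (rotates? a b))))

  orbits : ℕ → ℤ
  orbits a = ∑ p (λ b → ∑ p (orbit a b))

  orbits-0 : orbits 0 ≡ 0ℤ
  orbits-0 = ∑-0 p λ b _ → ∑-0 p λ c _ → go b c (rotates? 0 b)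
    where
    go : ∀ b c → Dec (Rotates 0 b) → orbit 0 b c ≡ 0ℤ
    go b c (yes 0b) = orbit-no₂ {0} {b} {c} (¬rotates-0 {b} {c} 0b)
    go b c (no ¬0b) = orbit-no₁ {0} {b} {c} ¬0b

  orbits-∞ : ∀ {a} → suc a ≡ p → orbits a ≡ 0ℤ
  orbits-∞ {a} eq = ∑-0 p λ b _ → ∑-0 p λ c _ → orbit-no₁ {a} {b} {c} (¬rotates-∞ {a} {b} eq)

  -- Neither a residue from 1 to p - 2 nor its image is -1 modulo p, so b and then c exist and are
  -- unique below p.
  orbits-generic : ∀ {a} → suc (suc a) < p → orbits (suc a) ≡ 1ℤ
  orbits-generic {a′} 2+a<p = single-b (neg-inverse p∤1+a)
    where
    a = suc a′
    p∤1+a : ¬ p ℕ∣.∣ suc a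
    p∤1+a p∣ = ℕₚ.<⇒≱ 2+a<p (ℕ∣.∣⇒≤ p∣)
    -- The relation between a and b gives (1 + a)(1 + b) ≡ a (mod p), and 0 < a < p.
    p∤1+b : ∀ {b} → Rotates a b → ¬ p ℕ∣.∣ suc b
    p∤1+b {b} ab p∣1+b = ℕₚ.<⇒≱ (ℕₚ.<-trans (ℕₚ.n<1+n a) 2+a<p) (ℕ∣.∣⇒≤ (ℕ∣.∣m+n∣m⇒∣n
      (subst (p ℕ∣.∣_) (lemma a b) (ℕ∣.∣n⇒∣m*n (suc a) p∣1+b)) ab))
      where
      lemma : ∀ a b → suc a ℕ.* suc b ≡ suc (suc a ℕ.* b) ℕ.+ a
      lemma = ℕ-RingSolver.solve-∀
    single-c : ∀ b → Rotates a b → ∃[ c ] c < p × Rotates b c → ∑ p (orbit a b) ≡ 1ℤ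
    single-c b ab (c , c<p , bc) = trans
      (∑-single p c c<p λ c′ c′<p c′≢c → orbit-no₂ {a} {b} {c′} λ bc′ →
        c′≢c (neg-inverse-unique {suc b} (p∤1+b {b} ab) c′<p c<p bc′ bc))
      (orbit-yes {a} {b} {c} ab bc)
    single-b : ∃[ b ] b < p × Rotates a b → orbits a ≡ 1ℤ
    single-b (b , b<p , ab) = trans
      (∑-single p b b<p λ b′ b′<p b′≢b → ∑-0 p λ c _ → orbit-no₁ {a} {b′} {c} λ ab′ →
        b′≢b (neg-inverse-unique {suc a} p∤1+a b′<p b<p ab′ ab))
      (single-c b ab (neg-inverse (p∤1+b {b} ab)))

  -- Of the starting points 0, ..., p - 1, all but 0 and p - 1 lie on exactly one closed path, which
  -- makes p - 2 paths. Rotation groups these in threes, since a constant path would be a fixed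
  -- point.
  noCubeRoot⇒∣p-2 : (∀ a → ¬ Rotates a a) → ∀ n → p ≡ suc (suc n) → 3 ℕ∣.∣ n
  noCubeRoot⇒∣p-2 ¬fixed n p≡2+n = ∣⇒∣ᵤ {+ 3} {+ n} (subst (+ 3 ∣_) count
    (∑∑∑-cyclic-∣3 p orbit orbit-cycle λ a → orbit-no₁ {a} {a} {a} (¬fixed a)))
    where
    open ≡-Reasoning
    ∑-1 : ∀ m → ∑ m (λ _ → 1ℤ) ≡ + m
    ∑-1 zero    = refl
    ∑-1 (suc m) = trans (cong (_+ 1ℤ) (∑-1 m)) (cong +_ (ℕₚ.+-comm m 1))
    count : ∑ p orbits ≡ + n
    count = begin
      ∑ p orbits                                                 ≡⟨ cong (λ m → ∑ m orbits) p≡2+n ⟩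
      ∑ (suc n) orbits + orbits (suc n)                          ≡⟨ cong₂ _+_ (∑-head n orbits) (orbits-∞ (sym p≡2+n)) ⟩
      orbits 0 + ∑ n (λ a → orbits (suc a)) + 0ℤ                 ≡⟨ cong₂ (λ x y → x + y + 0ℤ) orbits-0
                                                                    (∑-cong n λ a a<n → orbits-generic (subst (suc (suc a) <_) (sym p≡2+n) (s≤s (s≤s a<n)))) ⟩
      0ℤ + ∑ n (λ _ → 1ℤ) + 0ℤ                                   ≡⟨ ℤₚ.+-identityʳ _ ⟩
      0ℤ + ∑ n (λ _ → 1ℤ)                                        ≡⟨ ℤₚ.+-identityˡ _ ⟩
      ∑ n (λ _ → 1ℤ)                                             ≡⟨ ∑-1 n ⟩
      + n                                                        ∎

  -- 4 (1 + (1 + a) a) = (2 a + 1)^2 + 3.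
  cubeRoot⇒√-3 : ∀ {a} → Rotates a a → + p ℤ∣.∣ + odd a * + odd a - - + 3
  cubeRoot⇒√-3 {a} p∣ = subst (λ z → + p ℤ∣.∣ z - - + 3) (ℤₚ.pos-* (odd a) (odd a))
    (subst (p ℕ∣.∣_) (lemma a) (ℕ∣.∣n⇒∣m*n 4 p∣))
    where
    lemma : ∀ a → 4 ℕ.* suc (suc a ℕ.* a) ≡ suc (2 ℕ.* a) ℕ.* suc (2 ℕ.* a) ℕ.+ 3
    lemma = ℕ-RingSolver.solve-∀

  nonresidue⇒%3≡2 : 5 ≤ p → LegendreIsMinusOne (- (+ 3)) p → p % 3 ≡ 2
  nonresidue⇒%3≡2 5≤p nonresidue = conclude p≡2+n
    (noCubeRoot⇒∣p-2 (λ a aa → nonresidue (+ odd a , cubeRoot⇒√-3 {a} aa)) (p ∸ 2) p≡2+n)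
    where
    p≡2+n : p ≡ suc (suc (p ∸ 2))
    p≡2+n = sym (ℕₚ.m+[n∸m]≡n (ℕₚ.≤-trans (s≤s (s≤s z≤n)) 5≤p))
    conclude : ∀ {n} → p ≡ suc (suc n) → 3 ℕ∣.∣ n → p % 3 ≡ 2
    conclude eq (ℕ∣.divides q refl) = trans (cong (_% 3) eq) (ℕ/.[m+kn]%n≡m%n 2 q 3)

-- Coefficients of the r-th power and of the logarithmic derivative

mod4-^ : ∀ {f e} r → f ≡1+2 e mod4 → f ^ˢ r ≡1+2 + r · e mod4
mod4-^         zero    f≡ = mod4-one
mod4-^ {f} {e} (suc r) f≡ = mod4-respʳ-≈ (pointwise λ n → sym (ℤₚ.suc-* (+ r) (e n))) (⊛-mod4 f≡ (mod4-^ r f≡))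
  where
  mod4-respʳ-≈ : ∀ {f d e} → d ≈ e → f ≡1+2 d mod4 → f ≡1+2 e mod4
  mod4-respʳ-≈ d≈e (x , f≈) = x , ≈-trans f≈ (pointwise λ n →
    cong (λ z → one n + (z + z) + (x n + x n + (x n + x n))) (d≈e .at n))

^ˢ-0 : ∀ {f} r → f 0 ≡ 1ℤ → (f ^ˢ r) 0 ≡ 1ℤ
^ˢ-0 zero    f0≡1 = refl
^ˢ-0 (suc r) f0≡1 = cong₂ _*_ f0≡1 (^ˢ-0 r f0≡1)

∑halfFactor : ℕ → Series
∑halfFactor J n = ∑ J (λ j → halfFactor (2 ℕ.* j) (9 ℕ.* odd j ∸ 1) n)

∑logFactor : ℕ → Series
∑logFactor J n = ∑ J (λ j → logFactor (2 ℕ.* j) (9 ℕ.* odd j ∸ 1) n)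

∑halfFactor-even : ∀ {J n} → 0 < n → n ≤ J → 3 ℕ∣.∣ n → + 2 ∣ ∑halfFactor J n
∑halfFactor-even {J} {n} 0<n n≤J 3∣n = subst (+ 2 ∣_)
  (trans (sym (∑-distrib-+ J (λ j → ind (odd j ∣? n) + ind (9 ℕ.* odd j ∣? n))
      (λ j → halfFactor (2 ℕ.* j) (9 ℕ.* odd j ∸ 1) n - (ind (odd j ∣? n) + ind (9 ℕ.* odd j ∣? n)))))
    (∑-cong J λ j _ → lemma (ind (odd j ∣? n) + ind (9 ℕ.* odd j ∣? n)) (halfFactor (2 ℕ.* j) (9 ℕ.* odd j ∸ 1) n)))
  (∣m∣n⇒∣m+n (∑odd-ind-even 0<n n≤J 3∣n) (∑-∣ J λ j _ → halfFactor-mod2 (2 ℕ.* j) (9 ℕ.* odd j ∸ 1) 0<n))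
  where
  lemma : ∀ x y → x + (y - x) ≡ y
  lemma = solve-∀

∑logFactor-even : ∀ J {n} → 2 ℕ∣.∣ n → ∑logFactor J n ≡ 0ℤ
∑logFactor-even J 2∣n = ∑-0 J λ j _ → logFactor-even {2 ℕ.* j} {9 ℕ.* odd j ∸ 1} (odd-∤ j) (9*odd-∤ j) 2∣n

-- Weighted by k rather than 9 k, so that in `σ` + `σ₉` both indicators share the weight k.
σ₉ : ℕ → ℕ → ℤ
σ₉ J n = ∑odd J (λ k → + k * ind (9 ℕ.* k ∣? n))

∑logFactor-odd : ∀ J {n} → ¬ 2 ℕ∣.∣ n → ∑logFactor J n ≡ + 2 * (σ J n - + 9 * σ₉ J n)
∑logFactor-odd J {n} 2∤n = begin
  ∑logFactor J n
    ≡⟨ ∑-cong J (λ j _ → trans (logFactor-odd {2 ℕ.* j} {9 ℕ.* odd j ∸ 1} 2∤n)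
        (trans (cong (λ x → + 2 * (+ odd j * d j - x * d₉ j)) (ℤₚ.pos-* 9 (odd j))) (lemma (+ odd j) (d j) (d₉ j)))) ⟩
  ∑ J (λ j → + 2 * (+ odd j * d j) + - + 18 * (+ odd j * d₉ j))
    ≡⟨ ∑-distrib-+ J (λ j → + 2 * (+ odd j * d j)) (λ j → - + 18 * (+ odd j * d₉ j)) ⟩
  ∑ J (λ j → + 2 * (+ odd j * d j)) + ∑ J (λ j → - + 18 * (+ odd j * d₉ j))
    ≡⟨ cong₂ _+_ (*-distribˡ-∑ J (+ 2) (λ j → + odd j * d j)) (*-distribˡ-∑ J (- + 18) (λ j → + odd j * d₉ j)) ⟨
  + 2 * σ J n + - + 18 * σ₉ J n
    ≡⟨ collect (σ J n) (σ₉ J n) ⟩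
  + 2 * (σ J n - + 9 * σ₉ J n) ∎
  where
  open ≡-Reasoning
  d d₉ : ℕ → ℤ
  d j = ind (odd j ∣? n)
  d₉ j = ind (9 ℕ.* odd j ∣? n)
  lemma : ∀ k x y → + 2 * (k * x - + 9 * k * y) ≡ + 2 * (k * x) + - + 18 * (k * y)
  lemma = solve-∀
  collect : ∀ s t → + 2 * s + - + 18 * t ≡ + 2 * (s - + 9 * t)
  collect = solve-∀

%3≡⇒3∤ : ∀ {n r} → n % 3 ≡ suc r → ¬ 3 ℕ∣.∣ n
%3≡⇒3∤ {n} eq 3∣n with trans (sym eq) (ℕ∣.n∣m⇒m%n≡0 n 3 3∣n)
... | ()

σ₉-vanishes : ∀ J {n} → ¬ 3 ℕ∣.∣ n → σ₉ J n ≡ 0ℤ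
σ₉-vanishes J {n} 3∤n = ∑-0 J λ j _ → trans
  (cong (_*_ (+ odd j)) (ind-no (9 ℕ.* odd j ∣? n) λ 9k∣n →
    3∤n (ℕ∣.∣-trans (ℕ∣.divides 3 refl) (ℕ∣.∣-trans (ℕ∣.m∣m*n {9} (odd j)) 9k∣n))))
  (ℤₚ.*-zeroʳ (+ odd j))

∑logFactor-σ : ∀ J {n} → ¬ 2 ℕ∣.∣ n → ¬ 3 ℕ∣.∣ n → ∑logFactor J n ≡ + 2 * σ J n
∑logFactor-σ J {n} 2∤n 3∤n = trans (∑logFactor-odd J 2∤n)
  (trans (cong (λ x → + 2 * (σ J n - + 9 * x)) (σ₉-vanishes J 3∤n)) (cong (_*_ (+ 2)) (ℤₚ.+-identityʳ (σ J n))))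

σ-even : ∀ {J n} → ¬ 2 ℕ∣.∣ n → n % 3 ≡ 2 → n ≤ J → + 2 ∣ σ J n
σ-even {J} {n} 2∤n n%3≡2 n≤J = ∑odd-weighted-even {J} {λ k → ind (k ∣? n)} (odd-divisors-even 2∤n n%3≡2 n≤J)

∑logFactor-∣2 : ∀ J {n} → ¬ 2 ℕ∣.∣ n → + 2 ∣ ∑logFactor J n
∑logFactor-∣2 J {n} 2∤n = divides (σ J n - + 9 * σ₉ J n) (trans (∑logFactor-odd J 2∤n) (ℤₚ.*-comm (+ 2) _))

-- Half of the coefficient is σ - 9 σ₉ ≡ σ + σ₉ (mod 2). If 3 ∣ n, this is even by the pairing of k
-- with 3 k; if n ≡ 2 (mod 3), σ₉ vanishes and σ is even because n is not a square.
∑logFactor-∣4 : ∀ {J n} → ¬ 2 ℕ∣.∣ n → 0 < n → n ≤ J → n % 3 ≢ 1 → + 4 ∣ ∑logFactor J n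
∑logFactor-∣4 {J} {n} 2∤n 0<n n≤J n%3≢1 = go (n % 3) refl (ℕ/.m%n<n n 3)
  where
  go : ∀ r → n % 3 ≡ r → r < 3 → + 4 ∣ ∑logFactor J n
  -- The witness comes from σ - 9 σ₉ = (σ + σ₉) + 2 (-5 σ₉).
  go 0 n%3≡0 _ = subst (+ 4 ∣_) (sym (∑logFactor-odd J 2∤n)) (*-monoʳ-∣ (+ 2)
    (subst (+ 2 ∣_) (lemma (σ J n) (σ₉ J n)) (∣m∣n⇒∣m+n even (divides (- + 5 * σ₉ J n) refl))))
    where
    even : + 2 ∣ σ J n + σ₉ J n
    even = subst (+ 2 ∣_) (trans
      (∑-cong J λ j _ → ℤₚ.*-distribˡ-+ (+ odd j) (ind (odd j ∣? n)) (ind (9 ℕ.* odd j ∣? n)))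
      (∑-distrib-+ J (λ j → + odd j * ind (odd j ∣? n)) (λ j → + odd j * ind (9 ℕ.* odd j ∣? n))))
      (∑odd-weighted-even {J} {λ k → ind (k ∣? n) + ind (9 ℕ.* k ∣? n)}
        (∑odd-ind-even 0<n n≤J (ℕ∣.m%n≡0⇒n∣m n 3 n%3≡0)))
    lemma : ∀ s t → s + t + - + 5 * t * + 2 ≡ s - + 9 * t
    lemma = solve-∀
  go 1 n%3≡1 _ = contradiction n%3≡1 n%3≢1
  go 2 n%3≡2 _ = subst (+ 4 ∣_) (sym (∑logFactor-σ J 2∤n (%3≡⇒3∤ n%3≡2))) (*-monoʳ-∣ (+ 2) (σ-even 2∤n n%3≡2 n≤J))
  go (suc (suc (suc _))) _ (s≤s (s≤s (s≤s ())))

-- From the sum of divisors to divisibility by 8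

2^∣-odd : ∀ a {m n} → ¬ 2 ℕ∣.∣ n → 2 ℕ.^ a ℕ∣.∣ m ℕ.* n → 2 ℕ.^ a ℕ∣.∣ m
2^∣-odd zero    {m} 2∤n _ = ℕ∣.1∣ m
2^∣-odd (suc a) {m} {n} 2∤n 2^∣ with 2∣m*odd⇒2∣m {m} {n} 2∤n (ℕ∣.∣-trans (ℕ∣.m∣m*n (2 ℕ.^ a)) 2^∣)
... | ℕ∣.divides q refl = subst (2 ℕ.^ suc a ℕ∣.∣_) (ℕₚ.*-comm 2 q) (ℕ∣.*-monoʳ-∣ 2 (2^∣-odd a {q} 2∤n
  (ℕ∣.*-cancelˡ-∣ 2 (subst (2 ℕ.^ suc a ℕ∣.∣_) (lemma q n) 2^∣))))
  where
  lemma : ∀ q n → q ℕ.* 2 ℕ.* n ≡ 2 ℕ.* (q ℕ.* n)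
  lemma = ℕ-RingSolver.solve-∀

%3-cancel : ∀ {i n} → i ≤ n → (n ∸ i) % 3 ≡ n % 3 → 3 ℕ∣.∣ i
%3-cancel {i} {n} i≤n eq = ℕ∣.∣m+n∣m⇒∣n {m = (n ∸ i) / 3 ℕ.* 3}
  (ℕ∣.divides (n / 3) (ℕₚ.+-cancelˡ-≡ (n % 3) _ _ (begin
    n % 3 ℕ.+ ((n ∸ i) / 3 ℕ.* 3 ℕ.+ i)          ≡⟨ ℕₚ.+-assoc (n % 3) _ i ⟨
    n % 3 ℕ.+ (n ∸ i) / 3 ℕ.* 3 ℕ.+ i            ≡⟨ cong (λ r → r ℕ.+ (n ∸ i) / 3 ℕ.* 3 ℕ.+ i) eq ⟨
    (n ∸ i) % 3 ℕ.+ (n ∸ i) / 3 ℕ.* 3 ℕ.+ i      ≡⟨ cong (ℕ._+ i) (ℕ/.m≡m%n+[m/n]*n (n ∸ i) 3) ⟨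
    n ∸ i ℕ.+ i                                  ≡⟨ ℕₚ.m∸n+n≡m i≤n ⟩
    n                                            ≡⟨ ℕ/.m≡m%n+[m/n]*n n 3 ⟩
    n % 3 ℕ.+ n / 3 ℕ.* 3                        ∎)))
  (ℕ∣.n∣m*n ((n ∸ i) / 3))
  where open ≡-Reasoning

*-∣-* : ∀ {a b m n} → a ∣ m → b ∣ n → a * b ∣ m * n
*-∣-* {a} {b} {m} {n} a∣m b∣n = ∣-trans (*-monoʳ-∣ a b∣n) (*-monoˡ-∣ n a∣m)

∣8⇐σ : ∀ r {N} → ¬ 2 ℕ∣.∣ N → N % 3 ≡ 1 → + 4 ∣ σ (suc N) N → + 8 ∣ S9bar r N
-- The odd N is cancelled from 8 ∣ N S(N) on absolute values, with 8 read as 2^3.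
∣8⇐σ r {N} 2∤N N%3≡1 4∣σ = ∣ᵤ⇒∣ (2^∣-odd 3 {∣ S9bar r N ∣} {N} 2∤N
  (subst (8 ℕ∣.∣_) (trans (ℤₚ.abs-* (+ N) (S9bar r N)) (ℕₚ.*-comm N _)) (∣⇒∣ᵤ 8∣N*S)))
  where
  -- The number of factors in `S9bar r N`; it also bounds every index to which the divisor lemmas
  -- are applied.
  J = suc N
  P = prodFactors J
  P-mod4 : P ^ˢ r ≡1+2 + r · ∑halfFactor J mod4
  P-mod4 = mod4-^ r (prodFactors-mod4 J)
  Pʳ-0 : (P ^ˢ r) 0 ≡ 1ℤ
  Pʳ-0 = ^ˢ-0 r (prodFactors-0 J)
  term : ∀ i → i < suc N → + 8 ∣ (P ^ˢ r) i * ∑logFactor J (N ∸ i)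
  -- The power has constant term 1, and the other factor is 2 σ(N), so 8 arises as 2 times 4.
  term zero    _ = subst (+ 8 ∣_) (sym (trans (cong₂ _*_ Pʳ-0 (∑logFactor-σ J 2∤N (%3≡⇒3∤ N%3≡1))) (ℤₚ.*-identityˡ _)))
    (*-monoʳ-∣ (+ 2) 4∣σ)
  term i@(suc _) i<1+N = go (2 ∣? N ∸ i) ((N ∸ i) % 3 ℕ.≟ 1)
    where
    i≤N = ℕ.s≤s⁻¹ i<1+N
    s≤J : N ∸ i ≤ J
    s≤J = ℕₚ.≤-trans (ℕₚ.m∸n≤m N i) (ℕₚ.n≤1+n N)
    2∤s⇒0<s : ¬ 2 ℕ∣.∣ N ∸ i → 0 < N ∸ i
    2∤s⇒0<s 2∤s = ℕₚ.n≢0⇒n>0 λ s≡0 → 2∤s (subst (2 ℕ∣.∣_) (sym s≡0) (ℕ∣.divides 0 refl))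
    go : Dec (2 ℕ∣.∣ N ∸ i) → Dec ((N ∸ i) % 3 ≡ 1) → + 8 ∣ (P ^ˢ r) i * ∑logFactor J (N ∸ i)
    go (yes 2∣s) _ = divides 0ℤ (trans (cong (_*_ ((P ^ˢ r) i)) (∑logFactor-even J 2∣s)) (ℤₚ.*-zeroʳ ((P ^ˢ r) i)))
    -- N - i ≡ N (mod 3) forces 3 ∣ i, so the coefficient of the power supplies 4 and the
    -- logarithmic derivative 2.
    go (no 2∤s) (yes s%3≡1) = *-∣-* {+ 4} {+ 2} {(P ^ˢ r) i} {∑logFactor J (N ∸ i)}
      (mod4⇒∣4 P-mod4 (s≤s z≤n) (∣n⇒∣m*n (+ r) (∑halfFactor-even (s≤s z≤n) (ℕₚ.≤-trans i≤N (ℕₚ.n≤1+n N))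
        (%3-cancel i≤N (trans s%3≡1 (sym N%3≡1))))))
      (∑logFactor-∣2 J 2∤s)
    -- Here the roles of 2 and 4 are exchanged.
    go (no 2∤s) (no s%3≢1) = *-∣-* {+ 2} {+ 4} {(P ^ˢ r) i} {∑logFactor J (N ∸ i)}
      (mod4⇒∣2 P-mod4 (s≤s z≤n))
      (∑logFactor-∣4 2∤s (2∤s⇒0<s 2∤s) s≤J s%3≢1)
  8∣N*S : + 8 ∣ + N * S9bar r N
  8∣N*S = subst (+ 8 ∣_) (sym (trans (logDerivative-^ r (logDerivative-prodFactors J) .D≈ .at N)
    (⊛-∑ (P ^ˢ r) (+ r · ∑logFactor J) N)))
    (∑-∣ (suc N) λ i i<1+N → subst (+ 8 ∣_) (lemma (+ r) ((P ^ˢ r) i) (∑logFactor J (N ∸ i)))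
      (∣n⇒∣m*n (+ r) (term i i<1+N)))
    where
    lemma : ∀ r x y → r * (x * y) ≡ x * (r * y)
    lemma = solve-∀

-- Two uses of `σ-prime^` give σ(p^(e+2) m) = p^2 σ(p^e m) + (1 + p) σ(m), and the induction starts
-- from σ(p m) = (1 + p) σ(m). Here 1 + p = 2 (1 + h), and σ(m) is even.
σ-∣4 : ∀ h {J m} α → let p = odd h in Prime p → 0 < m → ¬ p ℕ∣.∣ m → + 2 ∣ σ J m →
       p ℕ.^ odd α ℕ.* m ≤ J → + 4 ∣ σ J (p ℕ.^ odd α ℕ.* m)
σ-∣4 h {J} {m} α p-prime 0<m p∤m 2∣σm = go α
  where
  p = odd h
  instance
    p-nonZero : NonZero p
    p-nonZero = prime⇒nonZero p-prime
  4∣ : + 4 ∣ (1ℤ + + p) * σ J m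
  4∣ = *-∣-* {+ 2} {+ 2} {1ℤ + + p} {σ J m} (divides (1ℤ + + h) (trans (cong (λ x → 1ℤ + (1ℤ + x)) (ℤₚ.pos-* 2 h)) (lemma (+ h)))) 2∣σm
    where
    lemma : ∀ h → 1ℤ + (1ℤ + + 2 * h) ≡ (1ℤ + h) * + 2
    lemma = solve-∀
  smaller : ∀ a → p ℕ.^ suc a ℕ.* m ≤ J → p ℕ.^ a ℕ.* m ≤ J
  smaller a = ℕₚ.≤-trans (ℕₚ.*-monoˡ-≤ m (ℕₚ.m≤n*m (p ℕ.^ a) p))
  exponent : ∀ α → odd (suc α) ≡ suc (suc (odd α))
  exponent α = cong suc (ℕₚ.*-suc 2 α)
  go : ∀ α → p ℕ.^ odd α ℕ.* m ≤ J → + 4 ∣ σ J (p ℕ.^ odd α ℕ.* m)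
  go zero n≤J = subst (+ 4 ∣_) (sym (trans (σ-prime^ h 0 p-prime 0<m p∤m n≤J)
    (trans (cong (λ x → + p * σ J x + σ J m) (ℕₚ.*-identityˡ m)) (lemma (+ p) (σ J m))))) 4∣
    where
    lemma : ∀ p s → p * s + s ≡ (1ℤ + p) * s
    lemma = solve-∀
  go (suc α) n≤J = subst (λ e → + 4 ∣ σ J (p ℕ.^ e ℕ.* m)) (sym (exponent α))
    (subst (+ 4 ∣_) (sym (trans (σ-prime^ h (suc (odd α)) p-prime 0<m p∤m n≤J′)
      (trans (cong (λ x → + p * x + σ J m) (σ-prime^ h (odd α) p-prime 0<m p∤m (smaller (suc (odd α)) n≤J′)))
      (lemma (+ p) (σ J (p ℕ.^ odd α ℕ.* m)) (σ J m)))))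
    (∣m∣n⇒∣m+n (∣n⇒∣m*n (+ p * + p) (go α (smaller (odd α) (smaller (suc (odd α)) n≤J′)))) 4∣))
    where
    n≤J′ : p ℕ.^ suc (suc (odd α)) ℕ.* m ≤ J
    n≤J′ = subst (λ e → p ℕ.^ e ℕ.* m ≤ J) (exponent α) n≤J
    lemma : ∀ p s t → p * (p * s + t) + t ≡ p * p * s + (1ℤ + p) * t
    lemma = solve-∀

-- The arithmetic progression

2∤^ : ∀ {p} → ¬ 2 ℕ∣.∣ p → ∀ a → ¬ 2 ℕ∣.∣ p ℕ.^ a
2∤^ 2∤p zero    2∣1 = odd-∤ 0 2∣1
2∤^ {p} 2∤p (suc a) 2∣ = 2∤^ 2∤p a (2∣m*odd⇒2∣m 2∤p (subst (2 ℕ∣.∣_) (ℕₚ.*-comm p (p ℕ.^ a)) 2∣))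

-- p^2 ≡ 1 (mod 3), so raising the exponent by 2 changes nothing.
^odd-%3 : ∀ {p} → p % 3 ≡ 2 → ∀ α → p ℕ.^ odd α % 3 ≡ 2
^odd-%3 {p} p%3≡2 zero = trans (cong (_% 3) (ℕₚ.*-identityʳ p)) p%3≡2
^odd-%3 {p} p%3≡2 (suc α) = begin
  p ℕ.^ odd (suc α) % 3                     ≡⟨ cong (λ e → p ℕ.^ suc e % 3) (ℕₚ.*-suc 2 α) ⟩
  p ℕ.* (p ℕ.* p ℕ.^ odd α) % 3             ≡⟨ cong (_% 3) (ℕₚ.*-assoc p p (p ℕ.^ odd α)) ⟨
  p ℕ.* p ℕ.* p ℕ.^ odd α % 3               ≡⟨ ℕ/.%-distribˡ-* (p ℕ.* p) (p ℕ.^ odd α) 3 ⟩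
  (p ℕ.* p % 3) ℕ.* (p ℕ.^ odd α % 3) % 3   ≡⟨ cong₂ (λ x y → x ℕ.* y % 3) (ℕ/.%-distribˡ-* p p 3) (^odd-%3 {p} p%3≡2 α) ⟩
  ((p % 3) ℕ.* (p % 3) % 3) ℕ.* 2 % 3       ≡⟨ cong (λ x → (x ℕ.* x % 3) ℕ.* 2 % 3) p%3≡2 ⟩
  2                                         ∎
  where open ≡-Reasoning

-- A prime p ≥ 5 divides neither 2 nor 3, and i is too small.
prime-∤-small : ∀ {p i} → Prime p → 5 ≤ p → 1 ≤ i → i < p → ¬ p ℕ∣.∣ 6 ℕ.* i
prime-∤-small {p} {i@(suc _)} p-prime 5≤p _ i<p p∣6i = Sum.[ ∤6 , (λ p∣i → ℕₚ.<⇒≱ i<p (ℕ∣.∣⇒≤ p∣i)) ]′ (euclidsLemma 6 i p-prime p∣6i)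
  where
  ∤6 : ¬ p ℕ∣.∣ 6
  ∤6 p∣6 = Sum.[ (λ p∣2 → ℕₚ.<⇒≱ (ℕₚ.≤-trans (s≤s (s≤s (s≤s z≤n))) 5≤p) (ℕ∣.∣⇒≤ p∣2))
               , (λ p∣3 → ℕₚ.<⇒≱ (ℕₚ.≤-trans (s≤s (s≤s (s≤s (s≤s z≤n)))) 5≤p) (ℕ∣.∣⇒≤ p∣3)) ]′ (euclidsLemma 2 3 p-prime p∣6)

prime⇒2∤ : ∀ {p} → Prime p → 5 ≤ p → ¬ 2 ℕ∣.∣ p
prime⇒2∤ p-prime 5≤p 2∣p with prime⇒irreducible p-prime 2∣p
... | inj₁ ()
... | inj₂ refl = contradiction 5≤p λ { (s≤s (s≤s ())) }

theorem3p9 : (p : ℕ) → Prime p → 5 ≤ p → LegendreIsMinusOne (- (+ 3)) p →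
    (m α n i : ℕ) → 1 ≤ i → i < p →
    (+ 8) ℤ∣.∣ S9bar (4 ℕ.* m ℕ.+ 1) (6 ℕ.* p ℕ.^ (2 ℕ.* α ℕ.+ 2) ℕ.* n ℕ.+ (6 ℕ.* i ℕ.+ p) ℕ.* p ℕ.^ (2 ℕ.* α ℕ.+ 1))
theorem3p9 p p-prime 5≤p nonresidue m α n i 1≤i i<p = ∣⇒∣ᵤ (subst (λ N → + 8 ∣ S9bar (4 ℕ.* m ℕ.+ 1) N) (sym factorised)
  (∣8⇐σ (4 ℕ.* m ℕ.+ 1) 2∤N N%3≡1 4∣σ))
  where
  open ≡-Reasoning
  -- The cofactor of p^(2 α + 1) in the given index.
  M = 6 ℕ.* p ℕ.* n ℕ.+ 6 ℕ.* i ℕ.+ p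
  N = p ℕ.^ odd α ℕ.* M
  2∤p : ¬ 2 ℕ∣.∣ p
  2∤p = prime⇒2∤ p-prime 5≤p
  p%3≡2 : p % 3 ≡ 2
  p%3≡2 = nonresidue⇒%3≡2 p-prime 5≤p nonresidue
  -- M ≡ p modulo 2 and modulo 3, while M ≡ 6 i modulo p.
  2∤M : ¬ 2 ℕ∣.∣ M
  2∤M 2∣M = 2∤p (ℕ∣.∣m+n∣m⇒∣n 2∣M (ℕ∣.divides (3 ℕ.* p ℕ.* n ℕ.+ 3 ℕ.* i) (lemma p n i)))
    where
    lemma : ∀ p n i → 6 ℕ.* p ℕ.* n ℕ.+ 6 ℕ.* i ≡ (3 ℕ.* p ℕ.* n ℕ.+ 3 ℕ.* i) ℕ.* 2
    lemma = ℕ-RingSolver.solve-∀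
  p∤M : ¬ p ℕ∣.∣ M
  p∤M p∣M = prime-∤-small p-prime 5≤p 1≤i i<p (ℕ∣.∣m+n∣m⇒∣n (subst (p ℕ∣.∣_) (lemma p n i) p∣M) (ℕ∣.m∣m*n (6 ℕ.* n ℕ.+ 1)))
    where
    lemma : ∀ p n i → 6 ℕ.* p ℕ.* n ℕ.+ 6 ℕ.* i ℕ.+ p ≡ p ℕ.* (6 ℕ.* n ℕ.+ 1) ℕ.+ 6 ℕ.* i
    lemma = ℕ-RingSolver.solve-∀
  M%3≡2 : M % 3 ≡ 2
  M%3≡2 = trans (cong (_% 3) (lemma p n i)) (trans (ℕ/.[m+kn]%n≡m%n p (2 ℕ.* p ℕ.* n ℕ.+ 2 ℕ.* i) 3) p%3≡2)
    where
    lemma : ∀ p n i → 6 ℕ.* p ℕ.* n ℕ.+ 6 ℕ.* i ℕ.+ p ≡ p ℕ.+ (2 ℕ.* p ℕ.* n ℕ.+ 2 ℕ.* i) ℕ.* 3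
    lemma = ℕ-RingSolver.solve-∀
  0<M : 0 < M
  0<M = ℕₚ.<-≤-trans (ℕₚ.<-≤-trans (s≤s z≤n) 5≤p) (ℕₚ.m≤n+m p (6 ℕ.* p ℕ.* n ℕ.+ 6 ℕ.* i))
  2∤N : ¬ 2 ℕ∣.∣ N
  2∤N 2∣N = 2∤^ 2∤p (odd α) (2∣m*odd⇒2∣m 2∤M 2∣N)
  N%3≡1 : N % 3 ≡ 1
  N%3≡1 = trans (ℕ/.%-distribˡ-* (p ℕ.^ odd α) M 3) (cong₂ (λ x y → x ℕ.* y % 3) (^odd-%3 {p} p%3≡2 α) M%3≡2)
  M≤J : M ≤ suc N
  M≤J = ℕₚ.≤-trans (ℕₚ.m≤n*m M (p ℕ.^ odd α) {{ℕₚ.m^n≢0 p (odd α) {{prime⇒nonZero p-prime}}}}) (ℕₚ.n≤1+n N)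
  4∣σ : + 4 ∣ σ (suc N) N
  4∣σ = go (¬2∣⇒odd p 2∤p)
    where
    -- Matching on `refl` replaces p by `odd h`, the form in which `σ-∣4` takes its prime.
    go : ∃[ h ] p ≡ odd h → + 4 ∣ σ (suc N) N
    go (h , refl) = σ-∣4 h α p-prime 0<M p∤M (σ-even 2∤M M%3≡2 M≤J) (ℕₚ.n≤1+n N)
  factorised : 6 ℕ.* p ℕ.^ (2 ℕ.* α ℕ.+ 2) ℕ.* n ℕ.+ (6 ℕ.* i ℕ.+ p) ℕ.* p ℕ.^ (2 ℕ.* α ℕ.+ 1) ≡ N
  factorised = trans (cong₂ (λ d e → 6 ℕ.* p ℕ.^ d ℕ.* n ℕ.+ (6 ℕ.* i ℕ.+ p) ℕ.* p ℕ.^ e)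
    (ℕₚ.+-comm (2 ℕ.* α) 2) (ℕₚ.+-comm (2 ℕ.* α) 1)) (lemma p (p ℕ.^ odd α) n i)
    where
    lemma : ∀ p q n i → 6 ℕ.* (p ℕ.* q) ℕ.* n ℕ.+ (6 ℕ.* i ℕ.+ p) ℕ.* q ≡ q ℕ.* (6 ℕ.* p ℕ.* n ℕ.+ 6 ℕ.* i ℕ.+ p)
    lemma = ℕ-RingSolver.solve-∀
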